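{- Let $G$ be a finite group of order $n$. Then $$\operatorname{sdim}(\mathcal{P}_R(G))=\begin{cases} 2^k-k, & \text{if } G\cong\mathbb{Z}_{2^k} \text{ for some } k\ge 1;\\ 2^{t+2}-t-1, & \text{if } G\cong Q_{4\cdot 2^t} \text{ for some } t\ge 1;\\ n-\max\{\Omega(m): m\in\pi_e(G)\}-1, & \text{otherwise.}\end{cases}$$
   Context: All groups are finite. The reduced power graph $\mathcal{P}_R(G)$ has vertex set $G$, two distinct vertices $x,y$ being adjacent iff $\langle x\rangle\subsetneq\langle y\rangle$ or $\langle y\rangle\subsetneq\langle x\rangle$. $\mathbb{Z}_m$ is the cyclic group of order $m$. For $n\ge 2$, the generalized quaternion group is $Q_{4n}=\langle x,y: x^n=y^2, x^{2n}=y^4=e, y^{ -1}xy=x^{ -1}\rangle$ (order $4n$). $\pi_e(G)$ is the set of element orders of $G$; $\Omega(m)$ is the number of prime factors of $m$ counted with multiplicity. For a graph $\Gamma$ and vertices $x,y,z$, $z$ strongly resolves $x$ and $y$ if there is a shortest path from $z$ to $x$ containing $y$ or a shortest path from $z$ to $y$ containing $x$; a strong resolving set is a vertex set $S$ such that every pair of distinct vertices is strongly resolved by some vertex of $S$; $\operatorname{sdim}(\Gamma)$ is the minimum size of a strong resolving set. -}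

module Defs where

open import Data.Nat using (ℕ; zero; suc; _+_; _*_; _∸_; _^_; _≤_; _<_; NonZero)
open import Data.Nat.Properties using (m*n≢0; m^n≢0)
open import Data.Nat.DivMod using (_mod_)
open import Data.Nat.Primality using (Prime)
open import Data.Fin using (Fin; toℕ)
open import Data.Fin.Subset using (Subset; _∈_; ∣_∣)
open import Data.Bool using (Bool; true; false)
open import Data.Product using (Σ; ∃; ∃-syntax; _×_; _,_)
open import Data.Sum using (_⊎_)
open import Relation.Nullary using (¬_)
open import Relation.Binary.PropositionalEquality using (_≡_)
open import Algebra.Structures using (IsGroup)

-- A finite group of order n: carrier Fin n (every finite group of order n
-- is isomorphic to one of this form), with propositional equality.

record FinGroup (n : ℕ) : Set where
  field
    _∙_     : Fin n → Fin n → Fin n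
    ε       : Fin n
    _⁻¹     : Fin n → Fin n
    isGroup : IsGroup _≡_ _∙_ ε _⁻¹

module _ {n : ℕ} (G : FinGroup n) where
  open FinGroup G

  pow : Fin n → ℕ → Fin n
  pow x zero    = ε
  pow x (suc k) = x ∙ pow x k

  InCyc : Fin n → Fin n → Set
  InCyc y x = ∃[ k ] pow x k ≡ y

  -- ⟨x⟩ ⊊ ⟨y⟩  (given ⟨x⟩ ⊆ ⟨y⟩ iff x ∈ ⟨y⟩)
  ProperCyc : Fin n → Fin n → Set
  ProperCyc x y = InCyc x y × ¬ InCyc y x

  Adj : Fin n → Fin n → Set
  Adj x y = ¬ (x ≡ y) × (ProperCyc x y ⊎ ProperCyc y x)

  data Walk : Fin n → Fin n → ℕ → Set where
    here : ∀ {x} → Walk x x zero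
    step : ∀ {x y z k} → Adj x y → Walk y z k → Walk x z (suc k)

  ShortestVia : Fin n → Fin n → Fin n → Set
  ShortestVia z x y = ∃[ a ] ∃[ b ] (Walk z y a × Walk y x b ×
                        (∀ m → Walk z x m → a + b ≤ m))

  StronglyResolves : Fin n → Fin n → Fin n → Set
  StronglyResolves z x y = ShortestVia z x y ⊎ ShortestVia z y x

  StrongResolvingSet : Subset n → Set
  StrongResolvingSet S = ∀ x y → ¬ (x ≡ y) →
    ∃[ z ] (z ∈ S × StronglyResolves z x y)

  SDimIs : ℕ → Set
  SDimIs d = (∃[ S ] (StrongResolvingSet S × ∣ S ∣ ≡ d)) ×
             (∀ S → StrongResolvingSet S → d ≤ ∣ S ∣)

  HasOrder : Fin n → ℕ → Set
  HasOrder x k = 1 ≤ k × pow x k ≡ ε × (∀ j → 1 ≤ j → j < k → ¬ (pow x j ≡ ε))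

data Omega : ℕ → ℕ → Set where
  one  : Omega 1 0
  mulp : ∀ {p m r} → Prime p → Omega m r → Omega (p * m) (suc r)

IsMaxOmega : ∀ {n} → FinGroup n → ℕ → Set
IsMaxOmega {n} G M =
  (∃[ x ] ∃[ m ] (HasOrder G x m × Omega m M)) ×
  (∀ (x : Fin n) m r → HasOrder G x m → Omega m r → r ≤ M)

record Iso {n : ℕ} (G : FinGroup n) (A : Set) (_⋆_ : A → A → A) : Set where
  open FinGroup G
  field
    to      : Fin n → A
    from    : A → Fin n
    from-to : ∀ x → from (to x) ≡ x
    to-from : ∀ a → to (from a) ≡ a
    hom     : ∀ x y → to (x ∙ y) ≡ to x ⋆ to y

zop : (m : ℕ) .{{_ : NonZero m}} → Fin m → Fin m → Fin m
zop m a b = (toℕ a + toℕ b) mod m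

IsoZ : ∀ {n} → FinGroup n → (m : ℕ) .{{_ : NonZero m}} → Set
IsoZ G m = Iso G (Fin m) (zop m)

-- Q_{4m}: elements x^i y^a with i ∈ Z_{2m}, a ∈ {0,1} encoded as (i , a).
-- Using y x^j = x^{-j} y and y^2 = x^m:
--   (i,0)(j,b) = (i+j, b);  (i,1)(j,0) = (i-j, 1);  (i,1)(j,1) = (i-j+m, 0).
qop : (m : ℕ) .{{_ : NonZero m}} →
      Fin (2 * m) × Bool → Fin (2 * m) × Bool → Fin (2 * m) × Bool
qop m {{nz}} (i , false) (j , b) = ((toℕ i + toℕ j) mod (2 * m)) {{m*n≢0 2 m}} , b
qop m {{nz}} (i , true) (j , false) =
  ((toℕ i + (2 * m ∸ toℕ j)) mod (2 * m)) {{m*n≢0 2 m}} , true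
qop m {{nz}} (i , true) (j , true) =
  ((toℕ i + (2 * m ∸ toℕ j) + m) mod (2 * m)) {{m*n≢0 2 m}} , false

IsoQ : ∀ {n} → FinGroup n → (m : ℕ) .{{_ : NonZero m}} → Set
IsoQ G m = Iso G (Fin (2 * m) × Bool) (qop m)

IsoZ2^ : ∀ {n} → FinGroup n → ℕ → Set
IsoZ2^ G k = IsoZ G (2 ^ k) {{m^n≢0 2 k}}

IsoQ2^ : ∀ {n} → FinGroup n → ℕ → Set
IsoQ2^ G t = IsoQ G (2 ^ t) {{m^n≢0 2 t}}

{-# OPTIONS --safe #-}

-- Since ε is adjacent to everything, the diameter is at most 2, and two vertices outside S are resolved by S
-- iff they are adjacent and some vertex is adjacent to exactly one of them.  So S is strongly resolving iff
-- its complement is a chain of cyclic subgroups ⟨x₁⟩ ⊊ ⟨x₂⟩ ⊊ … without closed twins.  Along a chain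
-- Ω(ord x) increases strictly, and below an element of order m there is a chain attaining 0, …, Ω(m).  The
-- only possible closed twins are ε and an involution z lying in every ⟨x⟩ with x ≠ ε; they cost one vertex,
-- and they occur exactly in cyclic and generalized quaternion 2-groups.
--
-- For the latter, let c have maximal order 2ᵏ.  Then ⟨c⟩ is its own centralizer, and an element normalising
-- ⟨c⟩ from outside inverts c and has square z.  If k ≤ 2, then ⟨c⟩ is normal.  If k ≥ 3, then H = N⟨c⟩
-- contains a conjugate x c x⁻¹ only if x ∈ H, so c fixes exactly one coset of H; hence [G : H] is odd, every
-- element of G fixes a coset, G is the union of the conjugates of H, and therefore G = H.

module Submission where

open import Defs
open import Level using (0ℓ)
open import Algebra.Bundles using (Group; CommutativeRing)
open import Data.Bool using (Bool; true; false; _xor_; _∧_; if_then_else_)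
import Data.Bool as Bool
open import Data.Bool.Properties using (xor-same; xor-identityʳ; ∧-zeroʳ; ∧-identityʳ; xor-∧-commutativeRing)
open import Data.Empty using (⊥)
open import Data.Fin using (Fin; zero; suc; toℕ; fromℕ<; punchIn; inject₁; fromℕ)
open import Data.Fin.Permutation using (permutation; ↔⇒≡)
open import Data.Fin.Properties
  using (any?; all?; _≟_; _<?_; <-cmp; ¬∀⟶∃¬; pigeonhole; injective⇒≤; suc-injective; punchOut-injective;
         punchInᵢ≢i; toℕ<n; toℕ-injective; toℕ-fromℕ<; toℕ-inject₁; toℕ-fromℕ; 2↔Bool; *↔×)
open import Data.Fin.Subset using (Subset; _∈_; _∉_; ∣_∣; ∁)
open import Data.Fin.Subset.Properties using (_∈?_; ∣∁p∣≡n∸∣p∣; x∈∁p⇒x∉p; x∉p⇒x∈∁p; x∉∁p⇒x∈p)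
open import Data.List as List using (List)
open import Data.List.Relation.Binary.Permutation.Propositional.Properties using (↭-length)
open import Data.List.Relation.Unary.All as All using (All)
open import Data.Nat
  using (ℕ; zero; suc; _+_; _*_; _∸_; _^_; _≤_; _<_; z≤n; s≤s; NonZero; nonTrivial⇒n>1; >-nonZero; ≢-nonZero⁻¹)
open import Data.Nat.Divisibility using (_∣_; divides; *-cancelˡ-∣)
open import Data.Nat.DivMod
  using (_%_; _/_; _mod_; m≡m%n+[m/n]*n; m%n<n; m<n⇒m%n≡m; n%n≡0; m*n%n≡0; %-distribˡ-+)
open import Data.Nat.Induction using (<-rec)
open import Data.Nat.ListAction using (product)
open import Data.Nat.Primality using (Prime; prime[2]; prime⇒nonTrivial)
open import Data.Nat.Primality.Factorisation using (PrimeFactorisation; factorise; factorisationUnique; factors)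
open import Data.Nat.Properties as ℕ hiding (_≟_; _<?_; suc-injective; <-cmp)
open import Data.Nat.Solver using (module +-*-Solver)
open import Data.Product using (Σ; ∃; ∃-syntax; _×_; _,_; proj₁; proj₂)
open import Data.Product.Function.NonDependent.Propositional using (_×-↔_)
open import Data.Sum using (_⊎_; inj₁; inj₂; [_,_]′)
import Data.Sum as Sum
open import Data.Vec using ([]; _∷_; here; there; tabulate)
open import Data.Vec.Functional using (removeAt)
open import Data.Vec.Properties using (lookup∘tabulate; []=⇒lookup; lookup⇒[]=)
open import Function using (_∘_; id)
open import Function.Bundles using (_↔_; mk↔ₛ′)
open import Function.Construct.Composition using (_↔-∘_)
open import Function.Construct.Identity using (↔-id)
open import Function.Construct.Symmetry using (↔-sym)
open import Relation.Binary.Definitions using (tri<; tri≈; tri>)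
open import Relation.Binary.PropositionalEquality
open import Relation.Nullary using (¬_; Dec; yes; no; does; contradiction)
open import Relation.Nullary.Decidable
  using (_×-dec_; _⊎-dec_; ¬?; map′; dec-true; dec-false; decidable-stable)
open import Relation.Unary using (Decidable)

open import Algebra.Properties.CommutativeMonoid.Sum (CommutativeRing.+-commutativeMonoid xor-∧-commutativeRing)
  using (sum; sum-cong-≗; ∑-distrib-+; sum-permute; sum-remove; sum-replicate-zero)

-- Finite search, injections between finite sets, subsets as images.

least : ∀ {P : ℕ → Set} → Decidable P → ∀ m → P m → ∃[ k ] (k ≤ m × P k × (∀ j → j < k → ¬ P j))
least P? zero p = zero , z≤n , p , λ _ ()
least {P} P? (suc m) p with P? zero
... | yes p0 = zero , z≤n , p0 , λ _ ()
... | no ¬p0 with least {P ∘ suc} (P? ∘ suc) m p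
...   | k , k≤m , pk , min = suc k , s≤s k≤m , pk , λ { zero _ → ¬p0 ; (suc j) (s≤s j<k) → min j j<k }

injective⇒surjective : ∀ {n} (f : Fin n → Fin n) → (∀ {i j} → f i ≡ f j → i ≡ j) → ∀ y → ∃[ x ] f x ≡ y
injective⇒surjective {suc n} f inj y with any? (λ x → f x ≟ y)
... | yes hit = hit
... | no ¬hit = contradiction (injective⇒≤ (λ {i} {j} eq → inj (punchOut-injective (avoid i) (avoid j) eq))) 1+n≰n
  where
  avoid : ∀ i → ¬ (y ≡ f i)
  avoid i eq = ¬hit (i , sym eq)

-- A section `s` of `f` is injective, hence onto by the previous lemma. So every point has the form
-- `s k`, and `f` recovers `k` from it.
surjective⇒injective : ∀ {n} (f : Fin n → Fin n) → (∀ y → ∃[ x ] f x ≡ y) → ∀ {i j} → f i ≡ f j → i ≡ j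
surjective⇒injective f sur {i} {j} eq
  with injective⇒surjective s s-injective i | injective⇒surjective s s-injective j
  where
  s = proj₁ ∘ sur
  s-injective : ∀ {k l} → s k ≡ s l → k ≡ l
  s-injective {k} {l} e = trans (sym (proj₂ (sur k))) (trans (cong f e) (proj₂ (sur l)))
... | k , refl | l , refl = cong (proj₁ ∘ sur) (trans (sym (proj₂ (sur k))) (trans eq (proj₂ (sur l))))

enumerate : ∀ {n} (S : Subset n) → Σ (Fin ∣ S ∣ → Fin n) λ f →
            (∀ i → f i ∈ S) × (∀ {i j} → f i ≡ f j → i ≡ j) × (∀ x → x ∈ S → ∃[ i ] f i ≡ x)
enumerate {zero} [] = (λ ()) , (λ ()) , (λ { {()} }) , λ ()
enumerate {suc n} (true ∷ S) with enumerate S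
... | f , f∈ , inj , onto = g , g∈ , (λ {i} {j} → g-inj i j) , g-onto
  where
  g : Fin (suc ∣ S ∣) → Fin (suc n)
  g zero = zero
  g (suc i) = suc (f i)
  g∈ : ∀ i → g i ∈ (true ∷ S)
  g∈ zero = here
  g∈ (suc i) = there (f∈ i)
  g-inj : ∀ i j → g i ≡ g j → i ≡ j
  g-inj zero zero _ = refl
  g-inj (suc i) (suc j) eq = cong suc (inj (suc-injective eq))
  g-onto : ∀ x → x ∈ (true ∷ S) → ∃[ i ] g i ≡ x
  g-onto zero _ = zero , refl
  g-onto (suc x) (there x∈) = let i , eq = onto x x∈ in suc i , cong suc eq
enumerate {suc n} (false ∷ S) with enumerate S
... | f , f∈ , inj , onto = suc ∘ f , there ∘ f∈ , inj ∘ suc-injective , g-onto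
  where
  g-onto : ∀ x → x ∈ (false ∷ S) → ∃[ i ] suc (f i) ≡ x
  g-onto (suc x) (there x∈) = let i , eq = onto x x∈ in i , cong suc eq

image : ∀ {m n} → (Fin m → Fin n) → Subset n
image f = tabulate λ x → does (any? λ i → f i ≟ x)

∈-image : ∀ {m n} (f : Fin m → Fin n) i → f i ∈ image f
∈-image f i = lookup⇒[]= _ _ (trans (lookup∘tabulate _ (f i)) (dec-true (any? _) (i , refl)))

∈-image⁻ : ∀ {m n} (f : Fin m → Fin n) {x} → x ∈ image f → ∃[ i ] f i ≡ x
∈-image⁻ f {x} x∈ with any? (λ i → f i ≟ x)
                | trans (sym (lookup∘tabulate (λ x → does (any? λ i → f i ≟ x)) x)) ([]=⇒lookup x∈)
... | yes hit | _ = hit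
... | no _ | ()

-- `f` may consult the membership proof, because in `∣image∣` it returns the index that this proof
-- supplies.
injectiveOn⇒∣S∣≤ : ∀ {m n} (S : Subset n) (f : ∀ x → x ∈ S → Fin m) →
  (∀ x y (x∈ : x ∈ S) (y∈ : y ∈ S) → f x x∈ ≡ f y y∈ → x ≡ y) → ∣ S ∣ ≤ m
injectiveOn⇒∣S∣≤ S f inj with enumerate S
... | e , e∈ , e-inj , _ = injective⇒≤ {f = λ i → f (e i) (e∈ i)} λ eq → e-inj (inj _ _ _ _ eq)

∣image∣ : ∀ {m n} (f : Fin m → Fin n) → (∀ {i j} → f i ≡ f j → i ≡ j) → ∣ image f ∣ ≡ m
∣image∣ f inj with enumerate (image f)
... | e , _ , e-inj , onto = ≤-antisym
  (injectiveOn⇒∣S∣≤ (image f) (λ x x∈ → proj₁ (∈-image⁻ f x∈))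
    λ x y x∈ y∈ eq → trans (sym (proj₂ (∈-image⁻ f x∈))) (trans (cong f eq) (proj₂ (∈-image⁻ f y∈))))
  (injective⇒≤ {f = λ i → proj₁ (onto (f i) (∈-image f i))} λ {i} {j} eq →
    inj (trans (sym (proj₂ (onto (f i) (∈-image f i)))) (trans (cong e eq) (proj₂ (onto (f j) (∈-image f j))))))

-- In the monoid (Bool, xor), sum P is the parity of the number of points at which P is true.


-- The points of `P` that `σ` moves come in pairs x, σ x, each with one member in `lt` and one in
-- `gt`. Under `xor` the two contributions cancel, and only the fixed points remain.
sum-involution : ∀ {n} (P : Fin n → Bool) (σ : Fin n → Fin n) →
  (∀ x → P x ≡ true → P (σ x) ≡ true) → (∀ x → P x ≡ true → σ (σ x) ≡ x) →
  sum P ≡ sum (λ x → P x ∧ does (σ x ≟ x))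
sum-involution {n} P σ closed invol = begin
  sum P                              ≡⟨ sum-cong-≗ split ⟩
  sum (λ x → fix x xor (lt x xor gt x))
    ≡⟨ trans (∑-distrib-+ fix _) (cong (sum fix xor_) (∑-distrib-+ lt gt)) ⟩
  sum fix xor (sum lt xor sum gt)    ≡⟨ cong (λ b → sum fix xor (b xor sum gt)) lt≡gt ⟩
  sum fix xor (sum gt xor sum gt)    ≡⟨ cong (sum fix xor_) (xor-same (sum gt)) ⟩
  sum fix xor false                  ≡⟨ xor-identityʳ (sum fix) ⟩
  sum fix                            ∎
  where
  open ≡-Reasoning
  -- `σ` is involutive only on `P`. Extending it by the identity gives a permutation of all of
  -- `Fin n`, as `sum-permute` demands.
  τ : Fin n → Fin n
  τ x = if P x then σ x else x
  P∘τ : ∀ x → P (τ x) ≡ P x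
  P∘τ x with P x in eq
  ... | true = closed x eq
  ... | false = eq
  τ∘τ : ∀ x → τ (τ x) ≡ x
  τ∘τ x with P x in eq
  ... | true rewrite closed x eq = invol x eq
  ... | false rewrite eq = refl
  fix lt gt : Fin n → Bool
  fix x = P x ∧ does (σ x ≟ x)
  lt x = P x ∧ does (x <? τ x)
  gt x = P x ∧ does (τ x <? x)
  split : ∀ x → P x ≡ fix x xor (lt x xor gt x)
  split x with P x
  ... | false = refl
  ... | true with <-cmp x (σ x)
  ...   | tri< a ¬b ¬c rewrite dec-false (σ x ≟ x) (¬b ∘ sym) | dec-true (x <? σ x) a | dec-false (σ x <? x) ¬c = refl
  ...   | tri≈ ¬a b ¬c rewrite dec-true (σ x ≟ x) (sym b) | dec-false (x <? σ x) ¬a | dec-false (σ x <? x) ¬c = refl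
  ...   | tri> ¬a ¬b c rewrite dec-false (σ x ≟ x) (¬b ∘ sym) | dec-false (x <? σ x) ¬a | dec-true (σ x <? x) c = refl
  lt≡gt : sum lt ≡ sum gt
  lt≡gt = trans (sum-permute lt (permutation τ τ τ∘τ τ∘τ))
    (sum-cong-≗ λ x → cong₂ _∧_ (P∘τ x) (cong (λ y → does (τ x <? y)) (τ∘τ x)))

sum-singleton : ∀ {n} (P : Fin n → Bool) a → P a ≡ true → (∀ x → P x ≡ true → x ≡ a) → sum P ≡ true
sum-singleton {suc n} P a Pa uniq = begin
  sum P                        ≡⟨ sum-remove {i = a} P ⟩
  P a xor sum (removeAt P a)   ≡⟨ cong₂ _xor_ Pa (trans (sum-cong-≗ rest) (sum-replicate-zero n)) ⟩
  true                         ∎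
  where
  open ≡-Reasoning
  rest : ∀ i → P (punchIn a i) ≡ false
  rest i with P (punchIn a i) in eq
  ... | false = refl
  ... | true = contradiction (uniq _ eq) (punchInᵢ≢i a i)

sum-true : ∀ {n} (P : Fin n → Bool) → sum P ≡ true → ∃[ x ] P x ≡ true
sum-true {n} P odd with any? (λ x → P x Bool.≟ true)
... | yes hit = hit
... | no ¬hit = contradiction (trans (sym odd) (trans (sum-cong-≗ all-false) (sum-replicate-zero n))) λ ()
  where
  all-false : ∀ x → P x ≡ false
  all-false x with P x in eq
  ... | false = refl
  ... | true = contradiction (x , eq) ¬hit

-- Odd numbers modulo powers of two, and the function Ω.

even⊎odd : ∀ n → ∃[ m ] (n ≡ 2 * m ⊎ n ≡ 1 + 2 * m)
even⊎odd zero = 0 , inj₁ refl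
even⊎odd (suc n) with even⊎odd n
... | m , inj₁ refl = m , inj₂ refl
... | m , inj₂ refl = suc m , inj₁ (cong suc (sym (+-suc m (m + 0))))

-- If vw = 1 + 2ᵏq with q odd, then v(w + 2ᵏ) = 1 + 2ᵏ(q + v) and q + v is even.
odd-invertible-mod-2^ : ∀ m k → ∃[ w ] ∃[ q ] (1 + 2 * m) * w ≡ 1 + 2 ^ k * q
odd-invertible-mod-2^ m zero = 1 , 2 * m ,
  solve 1 (λ m → (con 1 :+ con 2 :* m) :* con 1 := con 1 :+ con 1 :* (con 2 :* m)) refl m
  where open +-*-Solver
odd-invertible-mod-2^ m (suc k) with odd-invertible-mod-2^ m k
... | w , q , eq with even⊎odd q
...   | r , inj₁ refl = w , r , trans eq
  (solve 2 (λ a r → con 1 :+ a :* (con 2 :* r) := con 1 :+ con 2 :* a :* r) refl (2 ^ k) r)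
  where open +-*-Solver
...   | r , inj₂ refl = w + 2 ^ k , 1 + r + m , (begin
  (1 + 2 * m) * (w + 2 ^ k)                            ≡⟨ *-distribˡ-+ (1 + 2 * m) w (2 ^ k) ⟩
  (1 + 2 * m) * w + (1 + 2 * m) * 2 ^ k                ≡⟨ cong (_+ (1 + 2 * m) * 2 ^ k) eq ⟩
  1 + 2 ^ k * (1 + 2 * r) + (1 + 2 * m) * 2 ^ k
    ≡⟨ solve 3 (λ a r m → con 1 :+ a :* (con 1 :+ con 2 :* r) :+ (con 1 :+ con 2 :* m) :* a
                          := con 1 :+ con 2 :* a :* (con 1 :+ r :+ m)) refl (2 ^ k) r m ⟩
  1 + 2 ^ suc k * (1 + r + m)                          ∎)
  where
  open ≡-Reasoning
  open +-*-Solver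

2^a*odd : ∀ n → 1 ≤ n → ∃[ a ] ∃[ m ] n ≡ 2 ^ a * (1 + 2 * m)
2^a*odd = <-rec _ λ n rec 1≤n → go n rec 1≤n (even⊎odd n)
  where
  go : ∀ n → (∀ {k} → k < n → 1 ≤ k → ∃[ a ] ∃[ m ] k ≡ 2 ^ a * (1 + 2 * m)) → 1 ≤ n →
       ∃[ m ] (n ≡ 2 * m ⊎ n ≡ 1 + 2 * m) → ∃[ a ] ∃[ m ] n ≡ 2 ^ a * (1 + 2 * m)
  go n rec 1≤n (m , inj₂ refl) = 0 , m , sym (+-identityʳ _)
  go n rec () (zero , inj₁ refl)
  go n rec 1≤n (suc l , inj₁ refl) with rec {suc l} (m<m+n (suc l) (s≤s z≤n)) (s≤s z≤n)
  ... | a , m , eq = suc a , m , trans (cong (2 *_) eq) (sym (*-assoc 2 (2 ^ a) (1 + 2 * m)))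

-- Through lists of primes, uniqueness of factorisation makes `Omega` single-valued, and existence
-- makes it total on positive numbers.
Omega⇒factorisation : ∀ {m r} → Omega m r → Σ (PrimeFactorisation m) λ f → List.length (factors f) ≡ r
Omega⇒factorisation one = record { factors = List.[] ; isFactorisation = refl ; factorsPrime = All.[] } , refl
Omega⇒factorisation (mulp {p} p-prime Ωm) =
  let f , len = Omega⇒factorisation Ωm
  in record { factors = p List.∷ factors f
            ; isFactorisation = cong (p *_) (PrimeFactorisation.isFactorisation f)
            ; factorsPrime = p-prime All.∷ PrimeFactorisation.factorsPrime f } , cong suc len

factorisation⇒Omega : ∀ {m} (f : PrimeFactorisation m) → Omega m (List.length (factors f))
factorisation⇒Omega record { factors = ps ; isFactorisation = refl ; factorsPrime = primes } = go primes
  where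
  go : ∀ {ps} → All Prime ps → Omega (product ps) (List.length ps)
  go All.[] = one
  go (p-prime All.∷ primes) = mulp p-prime (go primes)

Omega-unique : ∀ {m r s} → Omega m r → Omega m s → r ≡ s
Omega-unique Ωr Ωs with Omega⇒factorisation Ωr | Omega⇒factorisation Ωs
... | f , refl | g , refl = ↭-length (factorisationUnique f g)

Omega-total : ∀ m → 1 ≤ m → ∃[ r ] Omega m r
Omega-total (suc m) _ = _ , factorisation⇒Omega (factorise (suc m))

Omega-* : ∀ {m l r s} → Omega m r → Omega l s → Omega (m * l) (r + s)
Omega-* {l = l} one Ωl = subst (λ j → Omega j _) (sym (+-identityʳ l)) Ωl
Omega-* {l = l} {s = s} (mulp {p} {m} {r} p-prime Ωm) Ωl =
  subst (λ j → Omega j (suc r + s)) (sym (*-assoc p m l)) (mulp p-prime (Omega-* Ωm Ωl))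

Omega-0 : ∀ {m} → Omega m 0 → m ≡ 1
Omega-0 one = refl

Omega-2^ : ∀ k → Omega (2 ^ k) k
Omega-2^ zero = one
Omega-2^ (suc k) = mulp prime[2] (Omega-2^ k)

-- Ω is additive, and the cofactor has positive Ω: the value 0 would make it 1 and the two numbers
-- equal.
Omega-∣-< : ∀ {m l r s} → Omega m r → Omega l s → m ∣ l → 1 ≤ l → ¬ (m ≡ l) → r < s
Omega-∣-< {m} {r = r} Ωm Ωl (divides q refl) 1≤l m≢l = go q Ωl 1≤l m≢l
  where
  go : ∀ q {s} → Omega (q * m) s → 1 ≤ q * m → ¬ (m ≡ q * m) → r < s
  go (suc q) Ωl _ m≢l with Omega-total (suc q) (s≤s z≤n)
  ... | zero , Ωq = contradiction (sym (trans (cong (_* m) (Omega-0 Ωq)) (+-identityʳ m))) m≢l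
  ... | suc t , Ωq = subst (r <_) (Omega-unique (Omega-* Ωq Ωm) Ωl) (s≤s (m≤n+m r t))

-- Powers, element orders and cyclic subgroups of a finite group.

module GroupTheory {n : ℕ} (G : FinGroup n) where
  open FinGroup G renaming (_∙_ to infixl 7 _∙_; _⁻¹ to infix 8 _⁻¹) public

  group : Group 0ℓ 0ℓ
  group = record { isGroup = isGroup }

  open Group group using (assoc; identityˡ; identityʳ; inverseˡ; inverseʳ) public
  open import Algebra.Properties.Group group
    using (∙-cancelˡ; ∙-cancelʳ; inverseˡ-unique; inverseʳ-unique; ⁻¹-anti-homo-∙; ⁻¹-involutive) public

  infixr 8 _↑_
  _↑_ : Fin n → ℕ → Fin n
  _↑_ = pow G

  infix 4 _∈⟨_⟩
  _∈⟨_⟩ : Fin n → Fin n → Set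
  _∈⟨_⟩ = InCyc G

  ↑-+ : ∀ x j k → x ↑ (j + k) ≡ x ↑ j ∙ x ↑ k
  ↑-+ x zero k = sym (identityˡ _)
  ↑-+ x (suc j) k = trans (cong (x ∙_) (↑-+ x j k)) (sym (assoc x _ _))

  ↑-* : ∀ x j k → x ↑ (j * k) ≡ (x ↑ j) ↑ k
  ↑-* x j zero = cong (x ↑_) (*-zeroʳ j)
  ↑-* x j (suc k) = begin
    x ↑ (j * suc k)       ≡⟨ cong (x ↑_) (*-suc j k) ⟩
    x ↑ (j + j * k)       ≡⟨ ↑-+ x j (j * k) ⟩
    x ↑ j ∙ x ↑ (j * k)   ≡⟨ cong (x ↑ j ∙_) (↑-* x j k) ⟩
    (x ↑ j) ↑ suc k       ∎
    where open ≡-Reasoning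

  ↑-1 : ∀ x → x ↑ 1 ≡ x
  ↑-1 = identityʳ

  ↑-2 : ∀ x → x ↑ 2 ≡ x ∙ x
  ↑-2 x = cong (x ∙_) (↑-1 x)

  ε-↑ : ∀ k → ε ↑ k ≡ ε
  ε-↑ zero = refl
  ε-↑ (suc k) = trans (identityˡ _) (ε-↑ k)

  ↑-comm : ∀ x j k → x ↑ j ∙ x ↑ k ≡ x ↑ k ∙ x ↑ j
  ↑-comm x j k = trans (sym (↑-+ x j k)) (trans (cong (x ↑_) (+-comm j k)) (↑-+ x k j))

  ↑-swap : ∀ x j k → (x ↑ j) ↑ k ≡ (x ↑ k) ↑ j
  ↑-swap x j k = trans (sym (↑-* x j k)) (trans (cong (x ↑_) (*-comm j k)) (↑-* x k j))

  ↑-*-ε : ∀ x j k → x ↑ j ≡ ε → x ↑ (j * k) ≡ ε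
  ↑-*-ε x j k eq = trans (↑-* x j k) (trans (cong (_↑ k) eq) (ε-↑ k))

  ↑-% : ∀ x m k .{{_ : NonZero m}} → x ↑ m ≡ ε → x ↑ (k % m) ≡ x ↑ k
  ↑-% x m k x^m = sym (begin
    x ↑ k                            ≡⟨ cong (x ↑_) (m≡m%n+[m/n]*n k m) ⟩
    x ↑ (k % m + k / m * m)          ≡⟨ ↑-+ x (k % m) _ ⟩
    x ↑ (k % m) ∙ x ↑ (k / m * m)
      ≡⟨ cong (x ↑ (k % m) ∙_) (trans (cong (x ↑_) (*-comm (k / m) m)) (↑-*-ε x m (k / m) x^m)) ⟩
    x ↑ (k % m) ∙ ε                  ≡⟨ identityʳ _ ⟩
    x ↑ (k % m)                      ∎)
    where open ≡-Reasoning

  ↑-∸ : ∀ x {i j} → i ≤ j → x ↑ i ≡ x ↑ j → x ↑ (j ∸ i) ≡ ε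
  ↑-∸ x {i} {j} i≤j eq = sym (∙-cancelˡ (x ↑ i) _ _ (begin
    x ↑ i ∙ ε             ≡⟨ identityʳ _ ⟩
    x ↑ i                 ≡⟨ eq ⟩
    x ↑ j                 ≡⟨ cong (x ↑_) (m+[n∸m]≡n i≤j) ⟨
    x ↑ (i + (j ∸ i))     ≡⟨ ↑-+ x i (j ∸ i) ⟩
    x ↑ i ∙ x ↑ (j ∸ i)   ∎))
    where open ≡-Reasoning

  hasOrder : ∀ x → ∃[ m ] HasOrder G x m
  hasOrder x with pigeonhole (n<1+n n) (λ i → x ↑ toℕ i)
  ... | i , j , i<j , eq
    with least (λ k → (1 ℕ.≤? k) ×-dec (x ↑ k ≟ ε)) (toℕ j ∸ toℕ i) (m<n⇒0<n∸m i<j , ↑-∸ x (<⇒≤ i<j) eq)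
  ...   | k , _ , (1≤k , x^k) , min = k , 1≤k , x^k , λ l 1≤l l<k x^l → min l l<k (1≤l , x^l)

  ord : Fin n → ℕ
  ord x = proj₁ (hasOrder x)

  ↑-injective : ∀ {x m} → HasOrder G x m → ∀ {i j} → i < m → j < m → x ↑ i ≡ x ↑ j → i ≡ j
  ↑-injective {x} (_ , _ , min) {i} {j} i<m j<m eq with ℕ.<-cmp i j
  ... | tri≈ _ i≡j _ = i≡j
  ... | tri< i<j _ _ = contradiction (↑-∸ x (<⇒≤ i<j) eq) (min _ (m<n⇒0<n∸m i<j) (≤-<-trans (m∸n≤m j i) j<m))
  ... | tri> _ _ j<i = contradiction (↑-∸ x (<⇒≤ j<i) (sym eq)) (min _ (m<n⇒0<n∸m j<i) (≤-<-trans (m∸n≤m i j) i<m))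

  HasOrder-∣ : ∀ {x m k} → HasOrder G x m → x ↑ k ≡ ε → m ∣ k
  HasOrder-∣ {x} {suc m} {k} ox@(_ , x^m , _) x^k = divides (k / suc m)
    (trans (m≡m%n+[m/n]*n k (suc m)) (cong (_+ k / suc m * suc m)
      (↑-injective ox (m%n<n k (suc m)) (s≤s z≤n) (trans (↑-% x (suc m) k x^m) x^k))))

  cyc-↑ : ∀ x k → x ↑ k ∈⟨ x ⟩
  cyc-↑ x k = k , refl

  cyc-refl : ∀ x → x ∈⟨ x ⟩
  cyc-refl x = 1 , ↑-1 x

  cyc-ε : ∀ x → ε ∈⟨ x ⟩
  cyc-ε x = 0 , refl

  cyc-∙ : ∀ {x y z} → y ∈⟨ x ⟩ → z ∈⟨ x ⟩ → y ∙ z ∈⟨ x ⟩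
  cyc-∙ {x} (j , refl) (k , refl) = j + k , ↑-+ x j k

  cyc-pow : ∀ {x y} k → y ∈⟨ x ⟩ → y ↑ k ∈⟨ x ⟩
  cyc-pow {x} k (j , refl) = j * k , ↑-* x j k

  cyc-trans : ∀ {x y z} → z ∈⟨ y ⟩ → y ∈⟨ x ⟩ → z ∈⟨ x ⟩
  cyc-trans (k , refl) y∈x = cyc-pow k y∈x

  cyc-⁻¹ : ∀ {x y} → y ∈⟨ x ⟩ → y ⁻¹ ∈⟨ x ⟩
  cyc-⁻¹ {x} {y} y∈x with hasOrder y
  ... | suc m , _ , y^m , _ = subst (_∈⟨ x ⟩) (inverseʳ-unique y (y ↑ m) y^m) (cyc-pow m y∈x)

  cyc-of-ε : ∀ {x} → x ∈⟨ ε ⟩ → x ≡ ε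
  cyc-of-ε (k , refl) = ε-↑ k

  cyc-exponent : ∀ {x y} m → x ↑ m ≡ ε → y ∈⟨ x ⟩ → y ↑ m ≡ ε
  cyc-exponent {x} m x^m (k , refl) = trans (↑-swap x k m) (trans (cong (_↑ k) x^m) (ε-↑ k))

  cyc-reduce : ∀ {x y} m → 1 ≤ m → x ↑ m ≡ ε → y ∈⟨ x ⟩ → ∃[ i ] x ↑ toℕ {m} i ≡ y
  cyc-reduce {x} (suc m) _ x^m (k , refl) =
    k mod suc m , trans (cong (x ↑_) (toℕ-fromℕ< (m%n<n k (suc m)))) (↑-% x (suc m) k x^m)

  _∈⟨_⟩? : ∀ y x → Dec (y ∈⟨ x ⟩)
  y ∈⟨ x ⟩? = let m , 1≤m , x^m , _ = hasOrder x in
    map′ (λ (i , eq) → toℕ i , eq) (cyc-reduce m 1≤m x^m) (any? λ i → x ↑ toℕ {m} i ≟ y)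

  -- ⟨x⟩ ⊆ ⟨y⟩ have the same cardinality m, so i ↦ (the j with xⁱ = yʲ) is an injection of Fin m into itself.
  cyc-antisym : ∀ {x y m} → HasOrder G x m → HasOrder G y m → x ∈⟨ y ⟩ → y ∈⟨ x ⟩
  cyc-antisym {x} {y} {m} ox oy x∈y with cyc-reduce m (proj₁ oy) (proj₁ (proj₂ oy)) (cyc-refl y)
  ... | j , y^j with injective⇒surjective f f-injective j
    where
    index : (i : Fin m) → ∃[ j ] y ↑ toℕ {m} j ≡ x ↑ toℕ i
    index i = cyc-reduce m (proj₁ oy) (proj₁ (proj₂ oy)) (cyc-pow (toℕ i) x∈y)
    f = proj₁ ∘ index
    f-injective : ∀ {i i′} → f i ≡ f i′ → i ≡ i′
    f-injective {i} {i′} eq = toℕ-injective (↑-injective ox (toℕ<n i) (toℕ<n i′)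
      (trans (sym (proj₂ (index i))) (trans (cong (λ j → y ↑ toℕ j) eq) (proj₂ (index i′)))))
  ...   | i , refl = toℕ i , trans (sym (proj₂ (cyc-reduce m (proj₁ oy) (proj₁ (proj₂ oy)) (cyc-pow (toℕ i) x∈y)))) y^j

  rank : Fin n → ℕ
  rank x = proj₁ (Omega-total (ord x) (proj₁ (proj₂ (hasOrder x))))

  Omega-rank : ∀ x → Omega (ord x) (rank x)
  Omega-rank x = proj₂ (Omega-total (ord x) (proj₁ (proj₂ (hasOrder x))))

  -- The order of `x` divides that of `y`, and equal orders would turn the inclusion into an
  -- equality by `cyc-antisym`. Consequently the vertices of a clique have distinct ranks.
  rank-mono : ∀ {x y} → ProperCyc G x y → rank x < rank y
  rank-mono {x} {y} (x∈y , y∉x) = Omega-∣-< (Omega-rank x) (Omega-rank y)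
    (HasOrder-∣ ox (cyc-exponent (ord y) (proj₁ (proj₂ oy)) x∈y)) (proj₁ oy)
    λ eq → y∉x (cyc-antisym (subst (HasOrder G x) eq ox) oy x∈y)
    where
    ox = proj₂ (hasOrder x)
    oy = proj₂ (hasOrder y)

-- Strong resolution in the reduced power graph.

module StrongDimension {n : ℕ} (G : FinGroup n) where
  open GroupTheory G

  Adj-sym : ∀ {x y} → Adj G x y → Adj G y x
  Adj-sym (x≢y , comparable) = x≢y ∘ sym , Sum.swap comparable

  ProperCyc⇒Adj : ∀ {x y} → ProperCyc G x y → Adj G x y
  ProperCyc⇒Adj p@(_ , y∉x) = (λ { refl → y∉x (cyc-refl _) }) , inj₁ p

  ProperCyc-ε : ∀ {x} → ¬ x ≡ ε → ProperCyc G ε x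
  ProperCyc-ε {x} x≢ε = cyc-ε x , x≢ε ∘ cyc-of-ε

  Adj? : ∀ x y → Dec (Adj G x y)
  Adj? x y = ¬? (x ≟ y) ×-dec ((x ∈⟨ y ⟩? ×-dec ¬? (y ∈⟨ x ⟩?)) ⊎-dec (y ∈⟨ x ⟩? ×-dec ¬? (x ∈⟨ y ⟩?)))

  cyc-of-involution : ∀ {z w} → z ∙ z ≡ ε → w ∈⟨ z ⟩ → w ≡ ε ⊎ w ≡ z
  cyc-of-involution {z} zz w∈z with cyc-reduce 2 (s≤s z≤n) (trans (↑-2 z) zz) w∈z
  ... | zero , refl = inj₁ refl
  ... | suc zero , refl = inj₂ (↑-1 z)

  walk≤2 : ∀ x y → ∃[ m ] (m ≤ 2 × Walk G x y m)
  walk≤2 x y with x ≟ ε | y ≟ ε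
  ... | yes refl | yes refl = 0 , z≤n , here
  ... | yes refl | no y≢ε = 1 , s≤s z≤n , step (ProperCyc⇒Adj (ProperCyc-ε y≢ε)) here
  ... | no x≢ε | yes refl = 1 , s≤s z≤n , step (Adj-sym (ProperCyc⇒Adj (ProperCyc-ε x≢ε))) here
  ... | no x≢ε | no y≢ε = 2 , ≤-refl ,
    step (Adj-sym (ProperCyc⇒Adj (ProperCyc-ε x≢ε))) (step (ProperCyc⇒Adj (ProperCyc-ε y≢ε)) here)

  walk-1 : ∀ {x y} → Walk G x y 1 → Adj G x y
  walk-1 (step adj here) = adj

  -- Needed for pairs that meet `S`: a vertex of `S` resolves itself from any other vertex as soon
  -- as a shortest walk between them exists.
  geodesic : ∀ x y → ∃[ b ] (Walk G x y b × (∀ m → Walk G x y m → b ≤ m))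
  geodesic x y with x ≟ y | Adj? x y | walk≤2 x y
  ... | yes refl | _ | _ = 0 , here , λ _ _ → z≤n
  ... | no x≢y | yes adj | _ = 1 , step adj here , λ { zero here → contradiction refl x≢y ; (suc m) _ → s≤s z≤n }
  ... | no x≢y | no ¬adj | zero , _ , here = contradiction refl x≢y
  ... | no x≢y | no ¬adj | suc zero , _ , w = contradiction (walk-1 w) ¬adj
  ... | no x≢y | no ¬adj | suc (suc zero) , _ , w = 2 , w , λ where
    zero here → contradiction refl x≢y
    (suc zero) w₁ → contradiction (walk-1 w₁) ¬adj
    (suc (suc m)) _ → s≤s (s≤s z≤n)
  ... | no x≢y | no ¬adj | suc (suc (suc _)) , s≤s (s≤s ()) , _

  -- All distances are at most 2, so a shortest walk through an intermediate `y` consists of exactly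
  -- the two edges z - y - x. An edge from `z` to `x` would be shorter.
  ShortestVia⇒Adj : ∀ {z x y} → ShortestVia G z x y → ¬ z ≡ y → ¬ y ≡ x → Adj G y x × ¬ Adj G z x
  ShortestVia⇒Adj (_ , _ , here , _ , _) z≢y _ = contradiction refl z≢y
  ShortestVia⇒Adj (_ , _ , step _ _ , here , _) _ y≢x = contradiction refl y≢x
  ShortestVia⇒Adj (_ , _ , step _ here , step yx here , min) _ _ =
    yx , λ zx → contradiction (min 1 (step zx here)) λ { (s≤s ()) }
  ShortestVia⇒Adj {z} {x} (_ , _ , step _ (step {k = k} _ _) , step _ w , min) _ _ =
    let m , m≤2 , w′ = walk≤2 z x in contradiction (≤-trans (min m w′) m≤2) λ { (s≤s (s≤s p)) → m+1+n≰0 k p }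
    where
    m+1+n≰0 : ∀ m {k} → ¬ (m + suc k ≤ 0)
    m+1+n≰0 m p = contradiction (≤-trans (m≤n+m _ m) p) λ ()
  ShortestVia⇒Adj {z} {x} (_ , _ , step {k = k} _ here , step _ (step _ w) , min) _ _ =
    let m , m≤2 , w′ = walk≤2 z x in contradiction (≤-trans (min m w′) m≤2) λ { (s≤s (s≤s ())) }

  Adj⇒ShortestVia : ∀ {z x y} → ¬ z ≡ x → Adj G z y → Adj G y x → ¬ Adj G z x → ShortestVia G z x y
  Adj⇒ShortestVia z≢x zy yx ¬zx = 1 , 1 , step zy here , step yx here , λ where
    zero here → contradiction refl z≢x
    (suc zero) w → contradiction (walk-1 w) ¬zx
    (suc (suc m)) _ → s≤s (s≤s z≤n)

  -- The resolving vertex lies in `S`, so it differs from both `x` and `y`, and the last step of its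
  -- walk is an edge between them.
  complement-clique : ∀ {S} → StrongResolvingSet G S → ∀ {x y} → x ∉ S → y ∉ S → ¬ x ≡ y → Adj G x y
  complement-clique res {x} {y} x∉ y∉ x≢y with res x y x≢y
  ... | z , z∈ , inj₁ via = Adj-sym (proj₁ (ShortestVia⇒Adj via (λ { refl → y∉ z∈ }) (x≢y ∘ sym)))
  ... | z , z∈ , inj₂ via = proj₁ (ShortestVia⇒Adj via (λ { refl → x∉ z∈ }) x≢y)

  Adj⇒rank≢ : ∀ {x y} → Adj G x y → ¬ rank x ≡ rank y
  Adj⇒rank≢ (_ , inj₁ p) eq = <⇒≢ (rank-mono p) eq
  Adj⇒rank≢ (_ , inj₂ p) eq = <⇒≢ (rank-mono p) (sym eq)

  complement-bound : ∀ (S : Subset n) {r} → ∣ ∁ S ∣ ≤ r → n ∸ r ≤ ∣ S ∣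
  complement-bound S {r} ∁S≤r = m≤n+o⇒m∸n≤o n r (begin
    n                      ≤⟨ m≤n+m∸n n ∣ S ∣ ⟩
    ∣ S ∣ + (n ∸ ∣ S ∣)    ≡⟨ cong (∣ S ∣ +_) (∣∁p∣≡n∸∣p∣ S) ⟨
    ∣ S ∣ + ∣ ∁ S ∣        ≤⟨ +-monoʳ-≤ ∣ S ∣ ∁S≤r ⟩
    ∣ S ∣ + r              ≡⟨ +-comm ∣ S ∣ r ⟩
    r + ∣ S ∣              ∎)
    where open ≤-Reasoning

  -- The complement of `S` is a clique, so `rank` is injective on it and takes at most `M + 1`
  -- values.
  resolving-bound : ∀ {M} → (∀ x → rank x ≤ M) → ∀ S → StrongResolvingSet G S → n ∸ suc M ≤ ∣ S ∣
  resolving-bound {M} rank≤M S res = complement-bound S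
      (injectiveOn⇒∣S∣≤ (∁ S) (λ x _ → fromℕ< (s≤s (rank≤M x))) separates)
    where
    separates : ∀ x y → x ∈ ∁ S → y ∈ ∁ S → fromℕ< (s≤s (rank≤M x)) ≡ fromℕ< (s≤s (rank≤M y)) → x ≡ y
    separates x y x∈ y∈ eq with x ≟ y
    ... | yes x≡y = x≡y
    ... | no x≢y = contradiction
      (trans (sym (toℕ-fromℕ< (s≤s (rank≤M x)))) (trans (cong toℕ eq) (toℕ-fromℕ< (s≤s (rank≤M y)))))
      (Adj⇒rank≢ (complement-clique res (x∈∁p⇒x∉p x∈) (x∈∁p⇒x∉p y∈) x≢y))

  -- A universal involution is adjacent to all other vertices, so that it is a closed twin of ε.
  record UniversalInvolution (z : Fin n) : Set where
    field
      z≢ε : ¬ z ≡ ε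
      z²≡ε : z ∙ z ≡ ε
      z∈⟨_⟩ : ∀ {x} → ¬ x ≡ ε → z ∈⟨ x ⟩

  module _ {z : Fin n} (uz : UniversalInvolution z) where
    open UniversalInvolution uz

    -- Whichever of `ε` and `z` ends the walk from `w`, it is already adjacent to `w`, so the walk
    -- through the other one is not shortest.
    twins-unresolved : ∀ {S} → StrongResolvingSet G S → ε ∉ S → z ∉ S → ⊥
    twins-unresolved res ε∉ z∉ with res ε z (z≢ε ∘ sym)
    ... | w , w∈ , inj₁ via = proj₂ (ShortestVia⇒Adj via (λ { refl → z∉ w∈ }) z≢ε)
      (Adj-sym (ProperCyc⇒Adj (ProperCyc-ε λ { refl → ε∉ w∈ })))
    ... | w , w∈ , inj₂ via = proj₂ (ShortestVia⇒Adj via (λ { refl → ε∉ w∈ }) (z≢ε ∘ sym))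
      (Adj-sym (ProperCyc⇒Adj (z∈⟨_⟩ (λ { refl → ε∉ w∈ }) , λ w∈z →
        [ (λ { refl → ε∉ w∈ }) , (λ { refl → z∉ w∈ }) ]′ (cyc-of-involution z²≡ε w∈z))))

    -- Only `ε` has rank 0 and only `z` has rank 1, and at least one of the two lies in `S`. Hence
    -- merging the ranks 0 and 1 by truncated predecessor keeps the map injective on the complement
    -- and saves one value.
    resolving-bound-twin : ∀ {M} → (∀ x → rank x ≤ M) → ∀ S → StrongResolvingSet G S → n ∸ M ≤ ∣ S ∣
    resolving-bound-twin {M} rank≤M S res = complement-bound S
      (injectiveOn⇒∣S∣≤ (∁ S) (λ x _ → fromℕ< (pred-rank<M x)) separates)
      where
      rank-z : 1 ≤ rank z
      rank-z = ≤-trans (s≤s z≤n) (rank-mono (ProperCyc-ε z≢ε))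
      pred-rank<M : ∀ x → rank x ∸ 1 < M
      pred-rank<M x with rank x | rank≤M x
      -- For rank 0 the strict bound amounts to 0 < `M`, which holds because `z` has positive rank.
      ... | zero | _ = ≤-trans rank-z (rank≤M z)
      ... | suc r | r<M = r<M
      rank-0 : ∀ {x} → rank x ≡ 0 → x ≡ ε
      rank-0 {x} eq with x ≟ ε
      ... | yes x≡ε = x≡ε
      ... | no x≢ε = contradiction (subst (rank ε <_) eq (rank-mono (ProperCyc-ε x≢ε))) λ ()
      rank-1 : ∀ {y} → ¬ y ≡ ε → rank y ≡ 1 → y ≡ z
      rank-1 {y} y≢ε eq with y ∈⟨ z ⟩?
      ... | yes y∈z = [ (λ y≡ε → contradiction y≡ε y≢ε) , id ]′ (cyc-of-involution z²≡ε y∈z)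
      ... | no y∉z = contradiction (≤-trans (rank-mono (z∈⟨_⟩ y≢ε , y∉z)) (≤-reflexive eq)) (≤⇒≯ rank-z)
      collide : ∀ {x y} → x ∉ S → y ∉ S → rank x ≡ 0 → ¬ x ≡ y → rank y ≡ 1 → ⊥
      collide x∉ y∉ rx x≢y ry with rank-0 rx
      ... | refl with rank-1 (x≢y ∘ sym) ry
      ...   | refl = twins-unresolved res x∉ y∉
      separates : ∀ x y → x ∈ ∁ S → y ∈ ∁ S → fromℕ< (pred-rank<M x) ≡ fromℕ< (pred-rank<M y) → x ≡ y
      separates x y x∈ y∈ eq with x ≟ y
      ... | yes x≡y = x≡y
      ... | no x≢y with rank x in rx | rank y in ry
                      | Adj⇒rank≢ (complement-clique res (x∈∁p⇒x∉p x∈) (x∈∁p⇒x∉p y∈) x≢y)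
                      | trans (sym (toℕ-fromℕ< (pred-rank<M x))) (trans (cong toℕ eq) (toℕ-fromℕ< (pred-rank<M y)))
      ...   | zero | zero | r≢ | _ = contradiction refl r≢
      ...   | suc _ | suc _ | r≢ | e = contradiction (cong suc e) r≢
      ...   | zero | suc zero | _ | _ = contradiction (collide (x∈∁p⇒x∉p x∈) (x∈∁p⇒x∉p y∈) rx x≢y ry) id
      ...   | suc zero | zero | _ | _ = contradiction (collide (x∈∁p⇒x∉p y∈) (x∈∁p⇒x∉p x∈) ry (x≢y ∘ sym) rx) id

  -- For an involution `y` this is the failure to be universal. The element `w` will separate `y`
  -- from `ε`.
  Avoided : Fin n → Set
  Avoided y = ∃[ w ] (¬ w ≡ ε × ¬ (y ∈⟨ w ⟩))

  -- Indices run from the top of the chain downwards. The premise of `witness` leaves only an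
  -- involution `a i` with `a j` equal to `ε`, the one pair that can consist of closed twins.
  module Chain {r : ℕ} (a : Fin r → Fin n)
    (descending : ∀ (i j : Fin r) → toℕ i < toℕ j → ProperCyc G (a j) (a i))
    (witness : ∀ (i j : Fin r) → toℕ i < toℕ j → a i ∙ a i ≡ ε → Avoided (a i))
    where

    a-injective : ∀ {i j} → a i ≡ a j → i ≡ j
    a-injective {i} {j} eq with ℕ.<-cmp (toℕ i) (toℕ j)
    ... | tri< i<j _ _ = contradiction (subst (_∈⟨ a j ⟩) (sym eq) (cyc-refl (a j))) (proj₂ (descending i j i<j))
    ... | tri≈ _ i≡j _ = toℕ-injective i≡j
    ... | tri> _ _ j<i = contradiction (subst (_∈⟨ a i ⟩) eq (cyc-refl (a i))) (proj₂ (descending j i j<i))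

    a-clique : ∀ {i j} → ¬ a i ≡ a j → Adj G (a i) (a j)
    a-clique {i} {j} neq with ℕ.<-cmp (toℕ i) (toℕ j)
    ... | tri< i<j _ _ = Adj-sym (ProperCyc⇒Adj (descending i j i<j))
    ... | tri≈ _ i≡j _ = contradiction (cong a (toℕ-injective i≡j)) neq
    ... | tri> _ _ j<i = ProperCyc⇒Adj (descending j i j<i)

    private S = ∁ (image a)

    -- The chain is a clique, so any other member of it would be adjacent to `a i`.
    nonadjacent∈S : ∀ {z} i → ¬ z ≡ a i → ¬ Adj G z (a i) → z ∈ S
    nonadjacent∈S i z≢ ¬adj = x∉p⇒x∈∁p λ z∈ → let l , eq = ∈-image⁻ a z∈ in
      ¬adj (subst (λ z → Adj G z (a i)) eq (a-clique (z≢ ∘ trans (sym eq))))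

    -- If `y = a i` does not square to `ε`, then `y ⁻¹` is a different generator of ⟨y⟩: adjacent to
    -- `a j` like `y`, but not to `y`. Otherwise `a j` is `ε`, and an element avoiding `y` is
    -- adjacent to `ε` but not to `y`.
    separator : ∀ i j → toℕ i < toℕ j → ∃[ z ] (¬ z ≡ a i × Adj G z (a j) × ¬ Adj G z (a i))
    separator i j i<j with descending i j i<j | a i ∙ a i ≟ ε
    ... | x∈y , y∉x | no y²≢ε = y ⁻¹ , y⁻¹≢y , Adj-sym (ProperCyc⇒Adj (cyc-trans x∈y y∈y⁻¹ , y∉x ∘ cyc-trans y∈y⁻¹)) ,
      λ { (_ , inj₁ (_ , y∉)) → y∉ y∈y⁻¹ ; (_ , inj₂ (_ , y⁻¹∉)) → y⁻¹∉ (cyc-⁻¹ (cyc-refl y)) }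
      where
      y = a i
      y∈y⁻¹ : y ∈⟨ y ⁻¹ ⟩
      y∈y⁻¹ = subst (_∈⟨ y ⁻¹ ⟩) (⁻¹-involutive y) (cyc-⁻¹ (cyc-refl (y ⁻¹)))
      y⁻¹≢y : ¬ y ⁻¹ ≡ y
      y⁻¹≢y eq = y²≢ε (trans (cong (_∙ y) (sym eq)) (inverseˡ y))
    ... | x∈y , y∉x | yes y²≡ε with cyc-of-involution y²≡ε x∈y | witness i j i<j y²≡ε
    ...   | inj₂ x≡y | _ = contradiction (subst (a i ∈⟨_⟩) (sym x≡y) (cyc-refl (a i))) y∉x
    ...   | inj₁ x≡ε | w , w≢ε , y∉w =
      w , w≢y , subst (Adj G w) (sym x≡ε) (Adj-sym (ProperCyc⇒Adj (ProperCyc-ε w≢ε))) ,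
      λ { (_ , inj₁ (w∈y , _)) → [ w≢ε , w≢y ]′ (cyc-of-involution y²≡ε w∈y) ; (_ , inj₂ (y∈w , _)) → y∉w y∈w }
      where
      w≢y : ¬ w ≡ a i
      w≢y eq = y∉w (subst (a i ∈⟨_⟩) (sym eq) (cyc-refl (a i)))

    separate : ∀ i j → toℕ i < toℕ j → ∃[ z ] (z ∈ S × ShortestVia G z (a i) (a j))
    separate i j i<j with separator i j i<j
    ... | z , z≢ , zx , ¬zy = z , nonadjacent∈S i z≢ ¬zy , Adj⇒ShortestVia z≢ zx (ProperCyc⇒Adj (descending i j i<j)) ¬zy

    resolving : StrongResolvingSet G S
    resolving x y x≢y with x ∈? S | y ∈? S
    -- With `x` itself as resolving vertex the walk to `x` is empty, so every shortest walk to `y`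
    -- will do.
    ... | yes x∈ | _ = x , x∈ , inj₂ (let b , w , min = geodesic x y in 0 , b , here , w , min)
    ... | no _ | yes y∈ = y , y∈ , inj₁ (let b , w , min = geodesic y x in 0 , b , here , w , min)
    ... | no x∉ | no y∉ with ∈-image⁻ a (x∉∁p⇒x∈p x∉) | ∈-image⁻ a (x∉∁p⇒x∈p y∉)
    ...   | i , refl | j , refl with ℕ.<-cmp (toℕ i) (toℕ j)
    ...     | tri< i<j _ _ = let z , z∈ , via = separate i j i<j in z , z∈ , inj₁ via
    ...     | tri≈ _ i≡j _ = contradiction (cong a (toℕ-injective i≡j)) x≢y
    ...     | tri> _ _ j<i = let z , z∈ , via = separate j i j<i in z , z∈ , inj₂ via

    small-resolving-set : ∃[ S ] (StrongResolvingSet G S × ∣ S ∣ ≡ n ∸ r)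
    small-resolving-set = S , resolving , trans (∣∁p∣≡n∸∣p∣ (image a)) (cong (n ∸_) (∣image∣ a a-injective))

-- The strong dimension with and without a universal involution.

module DimensionFormulas {n : ℕ} (G : FinGroup n) where
  open GroupTheory G
  open StrongDimension G

  HasOrder-↑ : ∀ {x p m} → 1 ≤ p → HasOrder G x (p * m) → HasOrder G (x ↑ p) m
  HasOrder-↑ {x} {p} {zero} _ (1≤0 , _) = contradiction (subst (1 ≤_) (*-zeroʳ p) 1≤0) λ ()
  HasOrder-↑ {x} {p@(suc _)} {suc m} 1≤p (_ , x^pm , min) = s≤s z≤n , trans (sym (↑-* x p (suc m))) x^pm ,
    λ j 1≤j j<m x^pj → min (p * j) (*-mono-≤ 1≤p 1≤j) (*-monoʳ-< p j<m) (trans (↑-* x p j) x^pj)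

  -- Dividing the order by one prime at a time gives x, x^p, x^(pq), ..., with strictly smaller
  -- orders. The derivation of `Omega m r` provides the `r` primes, hence `r + 1` members, the last
  -- of which is `ε`.
  power-chain : ∀ {x m r} → Omega m r → HasOrder G x m → Σ (Fin (suc r) → Fin n) λ a →
    a zero ≡ x × (∀ i j → toℕ i < toℕ j → ProperCyc G (a j) (a i))
  power-chain {x} one ox = (λ _ → x) , refl , λ { zero zero () }
  power-chain {x} (mulp {p} {m} {r} p-prime Ωm) ox = a , refl , descending
    where
    2≤p : 2 ≤ p
    2≤p = nonTrivial⇒n>1 p {{prime⇒nonTrivial p-prime}}
    ox^p : HasOrder G (x ↑ p) m
    ox^p = HasOrder-↑ (≤-trans (s≤s z≤n) 2≤p) ox
    rest = power-chain Ωm ox^p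
    b = proj₁ rest
    a : Fin (suc (suc r)) → Fin n
    a zero = x
    a (suc i) = b i
    b∈x^p : ∀ j → b j ∈⟨ x ↑ p ⟩
    b∈x^p zero = subst (_∈⟨ x ↑ p ⟩) (sym (proj₁ (proj₂ rest))) (cyc-refl _)
    b∈x^p (suc j) = subst (b (suc j) ∈⟨_⟩) (proj₁ (proj₂ rest)) (proj₁ (proj₂ (proj₂ rest) zero (suc j) (s≤s z≤n)))
    x∉x^p : ¬ (x ∈⟨ x ↑ p ⟩)
    x∉x^p x∈ = proj₂ (proj₂ ox) m (proj₁ ox^p)
      (subst (_< p * m) (*-identityˡ m) (*-monoˡ-< m {{>-nonZero (proj₁ ox^p)}} 2≤p))
      (cyc-exponent m (proj₁ (proj₂ ox^p)) x∈)
    descending : ∀ i j → toℕ i < toℕ j → ProperCyc G (a j) (a i)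
    descending zero (suc j) _ = cyc-trans (b∈x^p j) (cyc-↑ x p) , λ x∈b → x∉x^p (cyc-trans x∈b (b∈x^p j))
    descending (suc i) (suc j) (s≤s i<j) = proj₂ (proj₂ rest) i j i<j

  ProperCyc-involution : ∀ {x y} → y ∙ y ≡ ε → ProperCyc G x y → x ≡ ε
  ProperCyc-involution {x} {y} y² (x∈y , y∉x) =
    [ id , (λ { refl → contradiction (cyc-refl y) y∉x }) ]′ (cyc-of-involution y² x∈y)

  -- The full power chain below an element of maximal Ω has `M + 1` members and so meets
  -- `resolving-bound`. An involution in it that no element avoids would be universal.
  sdim-without-twins : (∀ z → ¬ UniversalInvolution z) → ∀ M → IsMaxOmega G M → SDimIs G (n ∸ M ∸ 1)
  sdim-without-twins no-twin M ((x , m , ox , Ωm) , max) =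
    subst (SDimIs G) (trans (cong (n ∸_) (+-comm 1 M)) (sym (∸-+-assoc n M 1)))
      (small-resolving-set , resolving-bound λ y → max y (ord y) (rank y) (proj₂ (hasOrder y)) (Omega-rank y))
    where
    chain = power-chain Ωm ox
    a = proj₁ chain
    descending = proj₂ (proj₂ chain)
    witness : ∀ i j → toℕ i < toℕ j → a i ∙ a i ≡ ε → Avoided (a i)
    witness i j i<j y² with any? (λ w → ¬? (w ≟ ε) ×-dec ¬? (a i ∈⟨ w ⟩?))
    ... | yes w = w
    ... | no ¬w = contradiction record
      { z≢ε = λ y≡ε → proj₂ (descending i j i<j) (subst (_∈⟨ a j ⟩) (sym y≡ε) (cyc-ε (a j)))
      ; z²≡ε = y²
      ; z∈⟨_⟩ = λ {w} w≢ε → decidable-stable (a i ∈⟨ w ⟩?) λ y∉w → ¬w (w , w≢ε , y∉w)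
      } (no-twin (a i))
    open Chain a descending witness

  -- The order of `c` is the exponent of `G`, so no rank exceeds `K`. The power chain of `c` without
  -- its last member has exactly the `K` members that `resolving-bound-twin` allows.
  sdim-with-twins : ∀ {z c K} → UniversalInvolution z → HasOrder G c (2 ^ K) → (∀ x → x ↑ (2 ^ K) ≡ ε) → SDimIs G (n ∸ K)
  sdim-with-twins {z} {c} {K} uz oc exponent = small-resolving-set , resolving-bound-twin uz rank≤K
    where
    rank≤K : ∀ x → rank x ≤ K
    rank≤K x with ord x ℕ.≟ 2 ^ K
    ... | yes eq = ≤-reflexive (Omega-unique (Omega-rank x) (subst (λ m → Omega m K) (sym eq) (Omega-2^ K)))
    ... | no neq = <⇒≤ (Omega-∣-< (Omega-rank x) (Omega-2^ K) (HasOrder-∣ (proj₂ (hasOrder x)) (exponent x)) (m^n>0 2 K) neq)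
    chain = power-chain (Omega-2^ K) oc
    -- The whole chain has `K + 1` members and ends in `ε`. Here `inject₁` drops that end, so the
    -- twins never meet and `witness` holds vacuously.
    a : Fin K → Fin n
    a = proj₁ chain ∘ inject₁
    descending : ∀ i j → toℕ i < toℕ j → ProperCyc G (a j) (a i)
    descending i j i<j = proj₂ (proj₂ chain) _ _ (subst₂ _<_ (sym (toℕ-inject₁ i)) (sym (toℕ-inject₁ j)) i<j)
    a≢ε : ∀ j → ¬ a j ≡ ε
    a≢ε j eq = proj₂ (proj₂ (proj₂ chain) (inject₁ j) (fromℕ K)
        (subst₂ _<_ (sym (toℕ-inject₁ j)) (sym (toℕ-fromℕ K)) (toℕ<n j)))
      (subst (_∈⟨ proj₁ chain (fromℕ K) ⟩) (sym eq) (cyc-ε _))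
    witness : ∀ i j → toℕ i < toℕ j → a i ∙ a i ≡ ε → Avoided (a i)
    witness i j i<j y² = contradiction (ProperCyc-involution y² (descending i j i<j)) (a≢ε j)
    open Chain a descending witness

  -- Repeated squaring of `x` reaches `ε`. The last nontrivial power before that is an involution,
  -- hence equal to `z`.
  unique-involution⇒universal : ∀ {z} K → ¬ z ≡ ε → z ∙ z ≡ ε → (∀ x → x ∙ x ≡ ε → x ≡ ε ⊎ x ≡ z) →
    (∀ x → x ↑ (2 ^ K) ≡ ε) → UniversalInvolution z
  unique-involution⇒universal {z} K z≢ε z² unique exponent = record
    { z≢ε = z≢ε ; z²≡ε = z² ; z∈⟨_⟩ = λ {x} x≢ε → go K x x≢ε (exponent x) }
    where
    go : ∀ k x → ¬ x ≡ ε → x ↑ (2 ^ k) ≡ ε → z ∈⟨ x ⟩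
    go zero x x≢ε eq = contradiction (trans (sym (↑-1 x)) eq) x≢ε
    go (suc k) x x≢ε eq with x ↑ 2 ≟ ε
    ... | no x²≢ε = cyc-trans (go k (x ↑ 2) x²≢ε (trans (sym (↑-* x 2 (2 ^ k))) eq)) (cyc-↑ x 2)
    ... | yes x²≡ε with unique x (trans (sym (↑-2 x)) x²≡ε)
    ...   | inj₁ x≡ε = contradiction x≡ε x≢ε
    ...   | inj₂ refl = cyc-refl x

-- Cosets of a subgroup and the parity of the number of fixed cosets.

does-true : ∀ {P : Set} (P? : Dec P) → does P? ≡ true → P
does-true (yes p) _ = p

first : ∀ {n} {P : Fin n → Set} → Decidable P → ∃ P → ∃[ i ] (P i × (∀ j → P j → toℕ i ≤ toℕ j))
first {P = P} P? (i , pi) with least (λ k → any? λ j → (toℕ j ℕ.≟ k) ×-dec P? j) (toℕ i) (i , refl , pi)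
... | _ , _ , (j , refl , pj) , min = j , pj , λ l pl → ≮⇒≥ λ l<j → min (toℕ l) l<j (l , refl , pl)

module Cosets {n : ℕ} (G : FinGroup n) where
  open GroupTheory G

  module _ {H : Fin n → Set} (H? : Decidable H) (H-ε : H ε)
    (H-∙ : ∀ {x y} → H x → H y → H (x ∙ y)) (H-⁻¹ : ∀ {x} → H x → H (x ⁻¹)) where

    infix 4 _~_
    _~_ : Fin n → Fin n → Set
    x ~ y = H (x ⁻¹ ∙ y)

    ~-refl : ∀ x → x ~ x
    ~-refl x = subst H (sym (inverseˡ x)) H-ε

    ~-sym : ∀ {x y} → x ~ y → y ~ x
    ~-sym {x} {y} h = subst H (trans (⁻¹-anti-homo-∙ (x ⁻¹) y) (cong (y ⁻¹ ∙_) (⁻¹-involutive x))) (H-⁻¹ h)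

    cancel-middle : ∀ x y z → (x ∙ y ⁻¹) ∙ (y ∙ z) ≡ x ∙ z
    cancel-middle x y z = trans (assoc x (y ⁻¹) (y ∙ z)) (cong (x ∙_) (trans (sym (assoc (y ⁻¹) y z))
      (trans (cong (_∙ z) (inverseˡ y)) (identityˡ z))))

    ~-trans : ∀ {x y z} → x ~ y → y ~ z → x ~ z
    ~-trans {x} {y} {z} h h′ = subst H
      (trans (assoc (x ⁻¹) y _) (cong (x ⁻¹ ∙_)
        (trans (sym (assoc y (y ⁻¹) z)) (trans (cong (_∙ z) (inverseʳ y)) (identityˡ z)))))
      (H-∙ h h′)

    ~-∙ : ∀ g {x y} → x ~ y → g ∙ x ~ g ∙ y
    ~-∙ g {x} {y} h = subst H (sym (trans (cong (_∙ (g ∙ y)) (⁻¹-anti-homo-∙ g x)) (cancel-middle (x ⁻¹) g y))) h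

    private
      first-in-coset : ∀ x → ∃[ y ] (x ~ y × (∀ y′ → x ~ y′ → toℕ y ≤ toℕ y′))
      first-in-coset x = first (λ y → H? (x ⁻¹ ∙ y)) (x , ~-refl x)

    rep : Fin n → Fin n
    rep x = proj₁ (first-in-coset x)

    ~-rep : ∀ x → x ~ rep x
    ~-rep x = proj₁ (proj₂ (first-in-coset x))

    rep-cong : ∀ {x y} → x ~ y → rep x ≡ rep y
    rep-cong {x} {y} h = toℕ-injective (≤-antisym
      (proj₂ (proj₂ (first-in-coset x)) _ (~-trans h (~-rep y)))
      (proj₂ (proj₂ (first-in-coset y)) _ (~-trans (~-sym h) (~-rep x))))

    rep-rep : ∀ x → rep (rep x) ≡ rep x
    rep-rep x = sym (rep-cong (~-rep x))

    rep-≡⇒~ : ∀ {x y} → rep x ≡ rep y → x ~ y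
    rep-≡⇒~ {x} {y} eq = ~-trans (subst (x ~_) eq (~-rep x)) (~-sym (~-rep y))

    rep-∙-rep : ∀ g x → rep (g ∙ rep x) ≡ rep (g ∙ x)
    rep-∙-rep g x = sym (rep-cong (~-∙ g (~-rep x)))

    -- A coset is counted once, through its representative `t`. Thus `sum (fixes g)` is the parity
    -- of the number of left cosets fixed by `g`, and `sum (fixes ε)` that of the index of the
    -- subgroup.
    fixes : Fin n → Fin n → Bool
    fixes g t = does ((rep t ≟ t) ×-dec (rep (g ∙ t) ≟ t))

    fixes⇒ : ∀ {g t} → fixes g t ≡ true → rep t ≡ t × rep (g ∙ t) ≡ t
    fixes⇒ {g} {t} = does-true ((rep t ≟ t) ×-dec (rep (g ∙ t) ≟ t))

    ⇒fixes : ∀ {g t} → rep t ≡ t → rep (g ∙ t) ≡ t → fixes g t ≡ true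
    ⇒fixes {g} {t} p q = dec-true ((rep t ≟ t) ×-dec (rep (g ∙ t) ≟ t)) (p , q)

    -- On the cosets fixed by g², multiplication by `g` is an involution, and its fixed points are
    -- the cosets fixed by `g`.
    fixes-square : ∀ g → sum (fixes (g ∙ g)) ≡ sum (fixes g)
    fixes-square g = trans (sum-involution (fixes (g ∙ g)) σ closed invol) (sum-cong-≗ fixed)
      where
      σ : Fin n → Fin n
      σ t = rep (g ∙ t)
      rep-gg : ∀ t → rep (g ∙ σ t) ≡ rep (g ∙ g ∙ t)
      rep-gg t = trans (rep-∙-rep g (g ∙ t)) (cong rep (sym (assoc g g t)))
      closed : ∀ t → fixes (g ∙ g) t ≡ true → fixes (g ∙ g) (σ t) ≡ true
      closed t ft = let _ , ggt = fixes⇒ ft in ⇒fixes (rep-rep (g ∙ t)) (begin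
        rep (g ∙ g ∙ σ t)       ≡⟨ cong rep (assoc g g (σ t)) ⟩
        rep (g ∙ (g ∙ σ t))     ≡⟨ rep-∙-rep g _ ⟨
        rep (g ∙ rep (g ∙ σ t)) ≡⟨ cong (λ s → rep (g ∙ s)) (trans (rep-gg t) ggt) ⟩
        rep (g ∙ t)             ∎)
        where open ≡-Reasoning
      invol : ∀ t → fixes (g ∙ g) t ≡ true → σ (σ t) ≡ t
      invol t ft = trans (rep-gg t) (proj₂ (fixes⇒ ft))
      fixed : ∀ t → fixes (g ∙ g) t ∧ does (σ t ≟ t) ≡ fixes g t
      fixed t with σ t ≟ t
      ... | no _ = trans (∧-zeroʳ _) (sym (∧-zeroʳ _))
      ... | yes gt = trans (∧-identityʳ _) (trans (cong (λ b → does (rep t ≟ t) ∧ b)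
        (dec-true (_ ≟ _) (trans (sym (rep-gg t)) (trans (cong (λ s → rep (g ∙ s)) gt) gt)))) refl)

    -- This is the fixed point congruence for 2-groups acting on cosets, restricted to one element
    -- and reached by squaring `g` down to `ε`.
    fixes-parity : ∀ k g → g ↑ (2 ^ k) ≡ ε → sum (fixes g) ≡ sum (fixes ε)
    fixes-parity zero g eq = cong (sum ∘ fixes) (trans (sym (↑-1 g)) eq)
    fixes-parity (suc k) g eq = trans (sym (fixes-square g))
      (fixes-parity k (g ∙ g) (trans (cong (_↑ (2 ^ k)) (sym (↑-2 g))) (trans (sym (↑-* g 2 (2 ^ k))) eq)))

    -- c fixes exactly one coset, so [G : H] is odd and every g fixes a coset t H, i.e. g = t h t⁻¹ with h ∈ H.
    -- Hence x ↦ x (rep x)⁻¹ is onto; being injective and constant on representatives, it leaves only one coset.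
    self-normalising⇒whole : (∀ g → ∃[ k ] g ↑ (2 ^ k) ≡ ε) → ∀ {c} → H c →
      (∀ x → H (x ∙ c ∙ x ⁻¹) → H x) → ∀ x → H x
    self-normalising⇒whole exponent {c} Hc normal x = subst H (trans (cong (_∙ x) ε⁻¹≡ε) (identityˡ x)) (rep-≡⇒~ (begin
      rep ε        ≡⟨ surjective⇒injective f f-surjective (trans (f-rep ε) (sym (f-rep x))) ⟩
      rep x        ∎))
      where
      open ≡-Reasoning
      ε⁻¹≡ε : ε ⁻¹ ≡ ε
      ε⁻¹≡ε = sym (inverseʳ-unique ε ε (identityˡ ε))
      odd-index : sum (fixes ε) ≡ true
      odd-index = trans (sym (fixes-parity (proj₁ (exponent c)) c (proj₂ (exponent c))))
        (sum-singleton (fixes c) (rep ε) (⇒fixes (rep-rep ε) (trans (rep-∙-rep c ε) (rep-cong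
          (subst H (sym (trans (identityʳ _) (cong _⁻¹ (identityʳ c)))) (H-⁻¹ Hc))))) unique)
        where
        unique : ∀ t → fixes c t ≡ true → t ≡ rep ε
        unique t ft = trans (sym (proj₁ (fixes⇒ ft)))
          (rep-cong (~-sym (subst H (sym (trans (cong (_∙ t) ε⁻¹≡ε) (identityˡ t))) Ht)))
          where
          -- That `c` fixes the left coset of `t` means that t⁻¹ c t lies in `H`. So `normal` is
          -- applied to `t ⁻¹` rather than to `t`.
          c-conj : H (t ⁻¹ ∙ c ∙ t ⁻¹ ⁻¹)
          c-conj = subst H (trans (sym (assoc _ _ _)) (cong (t ⁻¹ ∙ c ∙_) (sym (⁻¹-involutive t))))
            (rep-≡⇒~ (trans (proj₁ (fixes⇒ ft)) (sym (proj₂ (fixes⇒ ft)))))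
          Ht : H t
          Ht = subst H (⁻¹-involutive t) (H-⁻¹ (normal (t ⁻¹) c-conj))
      f : Fin n → Fin n
      f x = x ∙ rep x ⁻¹
      f-rep : ∀ x → f (rep x) ≡ ε
      f-rep x = trans (cong (λ r → rep x ∙ r ⁻¹) (rep-rep x)) (inverseʳ (rep x))
      f-surjective : ∀ g → ∃[ x ] f x ≡ g
      f-surjective g with sum-true (fixes g) (trans (fixes-parity (proj₁ (exponent g)) g (proj₂ (exponent g))) odd-index)
      ... | t , ft = g ∙ t , trans (cong (λ r → g ∙ t ∙ r ⁻¹) (proj₂ (fixes⇒ ft)))
        (trans (assoc g t (t ⁻¹)) (trans (cong (g ∙_) (inverseʳ t)) (identityʳ g)))

-- Elements whose order is a power of two.

module TwoElements {n : ℕ} (G : FinGroup n) where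
  open GroupTheory G

  -- An inverse `w` of the odd exponent modulo 2ᵏ undoes the power.
  x∈⟨x^odd⟩ : ∀ {x} k m → x ↑ (2 ^ k) ≡ ε → x ∈⟨ x ↑ (1 + 2 * m) ⟩
  x∈⟨x^odd⟩ {x} k m eq with odd-invertible-mod-2^ m k
  ... | w , q , vw = w , (begin
    (x ↑ (1 + 2 * m)) ↑ w        ≡⟨ ↑-* x (1 + 2 * m) w ⟨
    x ↑ ((1 + 2 * m) * w)        ≡⟨ cong (x ↑_) vw ⟩
    x ∙ x ↑ (2 ^ k * q)          ≡⟨ cong (x ∙_) (↑-*-ε x (2 ^ k) q eq) ⟩
    x ∙ ε                        ≡⟨ identityʳ x ⟩
    x                            ∎)
    where open ≡-Reasoning

  x^odd≡ε⇒x≡ε : ∀ {x} k m → x ↑ (2 ^ k) ≡ ε → x ↑ (1 + 2 * m) ≡ ε → x ≡ ε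
  x^odd≡ε⇒x≡ε {x} k m eq x^odd = cyc-of-ε (subst (x ∈⟨_⟩) x^odd (x∈⟨x^odd⟩ k m eq))

  ↑2^-mono : ∀ {x a b} → a ≤ b → x ↑ (2 ^ a) ≡ ε → x ↑ (2 ^ b) ≡ ε
  ↑2^-mono {x} {a} {b} a≤b eq = subst (λ e → x ↑ e ≡ ε)
    (trans (sym (^-distribˡ-+-* 2 a (b ∸ a))) (cong (2 ^_) (m+[n∸m]≡n a≤b))) (↑-*-ε x (2 ^ a) (2 ^ (b ∸ a)) eq)

  -- If x^j = ε with j = 2ᵃ · odd, the odd factor can be cancelled. Since j < 2^(k+1) forces a ≤ k,
  -- this would give x^(2ᵏ) = ε.
  hasOrder-2^ : ∀ {x} k → x ↑ (2 ^ suc k) ≡ ε → ¬ x ↑ (2 ^ k) ≡ ε → HasOrder G x (2 ^ suc k)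
  hasOrder-2^ {x} k eq neq = m^n>0 2 (suc k) , eq , λ j 1≤j j<2^ x^j → go j 1≤j j<2^ x^j (2^a*odd j 1≤j)
    where
    go : ∀ j → 1 ≤ j → j < 2 ^ suc k → x ↑ j ≡ ε → ∃[ a ] ∃[ m ] j ≡ 2 ^ a * (1 + 2 * m) → ⊥
    go j _ j<2^ x^j (a , m , refl) = neq (↑2^-mono {x} a≤k (x^odd≡ε⇒x≡ε (suc k) m
      (cyc-exponent (2 ^ suc k) eq (cyc-↑ x (2 ^ a))) (trans (sym (↑-* x (2 ^ a) (1 + 2 * m))) x^j)))
      where
      a≤k : a ≤ k
      a≤k = ≮⇒≥ λ k<a → <⇒≱ j<2^ (≤-trans (^-monoʳ-≤ 2 k<a) (m≤m*n (2 ^ a) (1 + 2 * m)))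

-- The structure of groups with a universal involution.

uniform-bound : ∀ {n} (f : Fin n → ℕ) → ∃[ K ] (∀ i → f i ≤ K)
uniform-bound {zero} f = 0 , λ ()
uniform-bound {suc n} f with uniform-bound (f ∘ suc)
... | K , bound = f zero + K , λ { zero → m≤m+n _ K ; (suc i) → ≤-trans (bound i) (m≤n+m K _) }

module Classification {n : ℕ} (G : FinGroup n) where
  open import Algebra.Solver.Monoid (Group.monoid (GroupTheory.group G)) using (_⊕_; _⊜_) renaming (solve to ∙-solve)
  open GroupTheory G
  open StrongDimension G
  open TwoElements G

  module _ {z : Fin n} (uz : UniversalInvolution z) where
    open UniversalInvolution uz

    involution-unique : ∀ {x} → x ∙ x ≡ ε → x ≡ ε ⊎ x ≡ z
    involution-unique {x} x² with x ≟ ε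
    ... | yes x≡ε = inj₁ x≡ε
    ... | no x≢ε = [ (λ z≡ε → contradiction z≡ε z≢ε) , inj₂ ∘ sym ]′ (cyc-of-involution x² (z∈⟨_⟩ x≢ε))

    z-central : ∀ x → x ∙ z ≡ z ∙ x
    z-central x with x ≟ ε
    ... | yes refl = trans (identityˡ z) (sym (identityʳ z))
    ... | no x≢ε with z∈⟨_⟩ x≢ε
    ...   | k , refl = trans (cong (_∙ x ↑ k) (sym (↑-1 x))) (trans (↑-comm x 1 k) (cong (x ↑ k ∙_) (↑-1 x)))

    -- Let 2ᵃ be the 2-part of the order of `x`. If x^(2ᵃ) were not `ε`, then `z` would be a power
    -- of it and so have a trivial odd power, which is impossible for an involution.
    2-element : ∀ x → ∃[ a ] x ↑ (2 ^ a) ≡ ε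
    2-element x with hasOrder x
    ... | o , 1≤o , x^o , _ with 2^a*odd o 1≤o
    ...   | a , m , refl with x ↑ (2 ^ a) ≟ ε
    ...     | yes eq = a , eq
    ...     | no neq = contradiction (x^odd≡ε⇒x≡ε 1 m (trans (↑-2 z) z²≡ε)
      (cyc-exponent (1 + 2 * m) (trans (sym (↑-* x (2 ^ a) (1 + 2 * m))) x^o) (z∈⟨_⟩ neq))) z≢ε

    exponent : ∃[ K ] (∀ x → x ↑ (2 ^ K) ≡ ε)
    exponent with uniform-bound (proj₁ ∘ 2-element)
    ... | K , bound = K , λ x → ↑2^-mono {x} (bound x) (proj₂ (2-element x))

    -- The least exponent that is a power of two is not 1, since `z` is nontrivial, so it may be
    -- written 2^(k+1). Its minimality supplies `c`.
    maximal-cyclic : ∃[ k ] ∃[ c ] ((∀ x → x ↑ (2 ^ suc k) ≡ ε) × ¬ c ↑ (2 ^ k) ≡ ε)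
    maximal-cyclic = let K , 2^K = exponent in go (least (λ k → all? λ x → x ↑ (2 ^ k) ≟ ε) K 2^K)
      where
      go : ∀ {K} → ∃[ k ] (k ≤ K × (∀ x → x ↑ (2 ^ k) ≡ ε) × (∀ j → j < k → ¬ (∀ x → x ↑ (2 ^ j) ≡ ε))) →
        ∃[ k ] ∃[ c ] ((∀ x → x ↑ (2 ^ suc k) ≡ ε) × ¬ c ↑ (2 ^ k) ≡ ε)
      go (zero , _ , 2^0 , _) = contradiction (trans (sym (↑-1 z)) (2^0 z)) z≢ε
      go (suc k , _ , 2^1+k , min) =
        let c , c≢ = ¬∀⟶∃¬ n (λ x → x ↑ (2 ^ k) ≡ ε) (λ x → x ↑ (2 ^ k) ≟ ε) (min k (n<1+n k)) in k , c , 2^1+k , c≢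

    -- Here c has order 2¹⁺ᵏ, which is the exponent of G.
    module MaximalCyclic (k : ℕ) {c : Fin n} (2^1+k : ∀ x → x ↑ (2 ^ suc k) ≡ ε) (c^2^k≢ε : ¬ c ↑ (2 ^ k) ≡ ε) where

      c≢ε : ¬ c ≡ ε
      c≢ε refl = c^2^k≢ε (ε-↑ (2 ^ k))

      c^2^k≡z : c ↑ (2 ^ k) ≡ z
      c^2^k≡z = [ (λ eq → contradiction eq c^2^k≢ε) , id ]′ (involution-unique (begin
        c ↑ (2 ^ k) ∙ c ↑ (2 ^ k)   ≡⟨ ↑-2 _ ⟨
        (c ↑ (2 ^ k)) ↑ 2           ≡⟨ ↑-* c (2 ^ k) 2 ⟨
        c ↑ (2 ^ k * 2)             ≡⟨ cong (c ↑_) (*-comm (2 ^ k) 2) ⟩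
        c ↑ (2 ^ suc k)             ≡⟨ 2^1+k c ⟩
        ε                           ∎))
        where open ≡-Reasoning

      -- Squares are already killed by 2ᵏ, but `c` is not.
      not-generated-by-square : ∀ x → ¬ (c ∈⟨ x ∙ x ⟩)
      not-generated-by-square x c∈ = c^2^k≢ε (cyc-exponent (2 ^ k)
        (trans (cong (_↑ (2 ^ k)) (sym (↑-2 x))) (trans (sym (↑-* x 2 (2 ^ k))) (2^1+k x))) c∈)

      root-in-⟨c⟩ : ∀ {x} → x ∙ x ≡ ε → x ∈⟨ c ⟩
      root-in-⟨c⟩ x² with involution-unique x²
      ... | inj₁ refl = cyc-ε c
      ... | inj₂ refl = z∈⟨_⟩ c≢ε

      cyc-cancelʳ : ∀ {x y} → y ∈⟨ c ⟩ → x ∙ y ∈⟨ c ⟩ → x ∈⟨ c ⟩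
      cyc-cancelʳ {x} {y} y∈ xy∈ = subst (_∈⟨ c ⟩)
        (trans (assoc x y (y ⁻¹)) (trans (cong (x ∙_) (inverseʳ y)) (identityʳ x))) (cyc-∙ xy∈ (cyc-⁻¹ y∈))

      -- A square root of an odd power of c would have larger order than c.
      square-even : ∀ {x r} → x ∙ x ≡ c ↑ r → ∃[ s ] x ∙ x ≡ c ↑ (2 * s)
      square-even {x} {r} eq with even⊎odd r
      ... | s , inj₁ refl = s , eq
      ... | s , inj₂ refl = contradiction
        (subst (c ∈⟨_⟩) (sym eq) (x∈⟨x^odd⟩ (suc k) s (2^1+k c))) (not-generated-by-square x)

      cyc-comm : ∀ {x} → x ∙ c ≡ c ∙ x → ∀ {y} → y ∈⟨ c ⟩ → x ∙ y ≡ y ∙ x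
      cyc-comm {x} xc (zero , refl) = trans (identityʳ x) (sym (identityˡ x))
      cyc-comm {x} xc (suc j , refl) = begin
        x ∙ (c ∙ c ↑ j)   ≡⟨ assoc x c _ ⟨
        x ∙ c ∙ c ↑ j     ≡⟨ cong (_∙ c ↑ j) xc ⟩
        c ∙ x ∙ c ↑ j     ≡⟨ assoc c x _ ⟩
        c ∙ (x ∙ c ↑ j)   ≡⟨ cong (c ∙_) (cyc-comm xc (j , refl)) ⟩
        c ∙ (c ↑ j ∙ x)   ≡⟨ assoc c _ x ⟨
        c ∙ c ↑ j ∙ x     ∎
        where open ≡-Reasoning

      -- Descends from x^(2^(k+1)) = ε through the successive squares. Once x² lies in ⟨c⟩, it
      -- equals c^(2s) for some s. As `x` commutes with `c`, the product x c⁻ˢ squares to `ε` and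
      -- therefore lies in ⟨c⟩.
      centralizer : ∀ {x} → x ∙ c ≡ c ∙ x → x ∈⟨ c ⟩
      centralizer {x} xc = go (suc k) xc (subst (_∈⟨ c ⟩) (sym (2^1+k x)) (cyc-ε c))
        where
        open ≡-Reasoning
        go : ∀ i {x} → x ∙ c ≡ c ∙ x → x ↑ (2 ^ i) ∈⟨ c ⟩ → x ∈⟨ c ⟩
        go zero {x} xc x^1∈ = subst (_∈⟨ c ⟩) (↑-1 x) x^1∈
        go (suc i) {x} xc x^∈ with go i {x ∙ x} xxc
                                 (subst (_∈⟨ c ⟩) (trans (↑-* x 2 (2 ^ i)) (cong (_↑ (2 ^ i)) (↑-2 x))) x^∈)
          where
          xxc : x ∙ x ∙ c ≡ c ∙ (x ∙ x)
          xxc = begin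
            x ∙ x ∙ c     ≡⟨ assoc x x c ⟩
            x ∙ (x ∙ c)   ≡⟨ cong (x ∙_) xc ⟩
            x ∙ (c ∙ x)   ≡⟨ assoc x c x ⟨
            x ∙ c ∙ x     ≡⟨ cong (_∙ x) xc ⟩
            c ∙ x ∙ x     ≡⟨ assoc c x x ⟩
            c ∙ (x ∙ x)   ∎
        ... | r , c^r with square-even {x} {r} (sym c^r)
        ...   | s , xx = cyc-cancelʳ u∈ (root-in-⟨c⟩ (begin
          x ∙ u ∙ (x ∙ u)           ≡⟨ cong (λ w → x ∙ u ∙ w) (cyc-comm xc u∈) ⟩
          x ∙ u ∙ (u ∙ x)           ≡⟨ assoc x u _ ⟩
          x ∙ (u ∙ (u ∙ x))         ≡⟨ cong (x ∙_) (assoc u u x) ⟨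
          x ∙ (u ∙ u ∙ x)           ≡⟨ cong (x ∙_) (cyc-comm xc (cyc-∙ u∈ u∈)) ⟨
          x ∙ (x ∙ (u ∙ u))         ≡⟨ assoc x x _ ⟨
          x ∙ x ∙ (u ∙ u)           ≡⟨ cong₂ _∙_ (trans xx (trans (↑-swap-2 s) (↑-2 _)))
                                             (sym (⁻¹-anti-homo-∙ (c ↑ s) (c ↑ s))) ⟩
          c ↑ s ∙ c ↑ s ∙ (c ↑ s ∙ c ↑ s) ⁻¹ ≡⟨ inverseʳ _ ⟩
          ε                         ∎))
          where
          u = (c ↑ s) ⁻¹
          u∈ : u ∈⟨ c ⟩
          u∈ = cyc-⁻¹ (cyc-↑ c s)
          ↑-swap-2 : ∀ s → c ↑ (2 * s) ≡ (c ↑ s) ↑ 2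
          ↑-swap-2 s = trans (cong (c ↑_) (*-comm 2 s)) (↑-* c s 2)

      conj-↑ : ∀ {x} u → x ∙ c ≡ c ↑ u ∙ x → ∀ j → x ∙ c ↑ j ≡ c ↑ (u * j) ∙ x
      conj-↑ {x} u xc zero = trans (identityʳ x) (sym (trans (cong (λ e → c ↑ e ∙ x) (*-zeroʳ u)) (identityˡ x)))
      conj-↑ {x} u xc (suc j) = begin
        x ∙ (c ∙ c ↑ j)           ≡⟨ assoc x c _ ⟨
        x ∙ c ∙ c ↑ j             ≡⟨ cong (_∙ c ↑ j) xc ⟩
        c ↑ u ∙ x ∙ c ↑ j         ≡⟨ assoc _ x _ ⟩
        c ↑ u ∙ (x ∙ c ↑ j)       ≡⟨ cong (c ↑ u ∙_) (conj-↑ u xc j) ⟩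
        c ↑ u ∙ (c ↑ (u * j) ∙ x) ≡⟨ assoc _ _ x ⟨
        c ↑ u ∙ c ↑ (u * j) ∙ x   ≡⟨ cong (_∙ x) (trans (sym (↑-+ c u (u * j))) (cong (c ↑_) (sym (*-suc u j)))) ⟩
        c ↑ (u * suc j) ∙ x       ∎
        where open ≡-Reasoning

      square-of-xc^j : ∀ {x u r} → x ∙ c ≡ c ↑ u ∙ x → x ∙ x ≡ c ↑ r → ∀ j →
        x ∙ c ↑ j ∙ (x ∙ c ↑ j) ≡ c ↑ (u * j + j + r)
      square-of-xc^j {x} {u} {r} xc xx j = begin
        x ∙ c ↑ j ∙ (x ∙ c ↑ j)             ≡⟨ cong (_∙ (x ∙ c ↑ j)) (conj-↑ u xc j) ⟩
        c ↑ (u * j) ∙ x ∙ (x ∙ c ↑ j)       ≡⟨ assoc _ x _ ⟩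
        c ↑ (u * j) ∙ (x ∙ (x ∙ c ↑ j))     ≡⟨ cong (c ↑ (u * j) ∙_) (assoc x x _) ⟨
        c ↑ (u * j) ∙ (x ∙ x ∙ c ↑ j)       ≡⟨ cong (λ w → c ↑ (u * j) ∙ (w ∙ c ↑ j)) xx ⟩
        c ↑ (u * j) ∙ (c ↑ r ∙ c ↑ j)       ≡⟨ cong (c ↑ (u * j) ∙_) (↑-comm c r j) ⟩
        c ↑ (u * j) ∙ (c ↑ j ∙ c ↑ r)       ≡⟨ assoc _ _ _ ⟨
        c ↑ (u * j) ∙ c ↑ j ∙ c ↑ r         ≡⟨ cong (_∙ c ↑ r) (↑-+ c (u * j) j) ⟨
        c ↑ (u * j + j) ∙ c ↑ r             ≡⟨ ↑-+ c (u * j + j) r ⟨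
        c ↑ (u * j + j + r)                 ∎
        where open ≡-Reasoning

      -- Conjugation by such an `x` would send the nontrivial element c^(2ᵏ) to `ε`.
      conj-≢-even : ∀ {x} v → ¬ x ∙ c ≡ c ↑ (2 * v) ∙ x
      conj-≢-even {x} v xc = c^2^k≢ε (∙-cancelˡ x _ _ (begin
        x ∙ c ↑ (2 ^ k)             ≡⟨ conj-↑ (2 * v) xc (2 ^ k) ⟩
        c ↑ (2 * v * 2 ^ k) ∙ x
          ≡⟨ cong (λ e → c ↑ e ∙ x) (solve 2 (λ v a → con 2 :* v :* a := con 2 :* a :* v) refl v (2 ^ k)) ⟩
        c ↑ (2 ^ suc k * v) ∙ x     ≡⟨ cong (_∙ x) (↑-*-ε c (2 ^ suc k) v (2^1+k c)) ⟩
        ε ∙ x                       ≡⟨ identityˡ x ⟩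
        x                           ≡⟨ identityʳ x ⟨
        x ∙ ε                       ∎))
        where
        open ≡-Reasoning
        open +-*-Solver

      -- If u ≡ 1 (mod 4) then c^(u+1) generates ⟨c²⟩ ∋ x², and some x cʲ has square ε.
      conj-1mod4 : ∀ {x r} w → x ∙ c ≡ c ↑ (1 + 2 * (2 * w)) ∙ x → x ∙ x ≡ c ↑ r → x ∈⟨ c ⟩
      conj-1mod4 {x} {r} w xc xx with square-even {x} {r} xx
      ... | s , xx′ with cyc-trans (cyc-⁻¹ (s , trans (sym (↑-* c 2 s)) (sym xx′)))
                               (x∈⟨x^odd⟩ {c ↑ 2} (suc k) w (2^1+k (c ↑ 2)))
      ...   | j , eq = cyc-cancelʳ (cyc-↑ c j) (root-in-⟨c⟩ (begin
        x ∙ c ↑ j ∙ (x ∙ c ↑ j)                       ≡⟨ square-of-xc^j {u = 1 + 2 * (2 * w)} {r} xc xx j ⟩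
        c ↑ ((1 + 2 * (2 * w)) * j + j + r)           ≡⟨ ↑-+ c ((1 + 2 * (2 * w)) * j + j) r ⟩
        c ↑ ((1 + 2 * (2 * w)) * j + j) ∙ c ↑ r
          ≡⟨ cong₂ (λ e y → c ↑ e ∙ y)
             (solve 2 (λ w j → (con 1 :+ con 2 :* (con 2 :* w)) :* j :+ j
                              := con 2 :* ((con 1 :+ con 2 :* w) :* j)) refl w j) (sym xx) ⟩
        c ↑ (2 * ((1 + 2 * w) * j)) ∙ (x ∙ x)
          ≡⟨ cong (_∙ (x ∙ x)) (trans (↑-* c 2 ((1 + 2 * w) * j)) (trans (↑-* (c ↑ 2) (1 + 2 * w) j) eq)) ⟩
        (x ∙ x) ⁻¹ ∙ (x ∙ x)                          ≡⟨ inverseˡ _ ⟩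
        ε                                             ∎))
        where
        open ≡-Reasoning
        open +-*-Solver

      -- If u ≡ 3 (mod 4) then x² = cʳ commutes with x, so that c^(r(u-1)) = ε and hence (x²)² = ε.
      conj-3mod4 : ∀ {x r} w → x ∙ c ≡ c ↑ (3 + 2 * (2 * w)) ∙ x → x ∙ x ≡ c ↑ r → ¬ (x ∈⟨ c ⟩) → x ∙ x ≡ z
      conj-3mod4 {x} {r} w xc xx x∉ with involution-unique {x ∙ x} (begin
        x ∙ x ∙ (x ∙ x)        ≡⟨ ↑-2 (x ∙ x) ⟨
        (x ∙ x) ↑ 2            ≡⟨ x^odd≡ε⇒x≡ε (suc k) w (2^1+k _) odd-power ⟩
        ε                      ∎)
        where
        open ≡-Reasoning
        open +-*-Solver
        commute : c ↑ ((3 + 2 * (2 * w)) * r) ≡ c ↑ r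
        commute = ∙-cancelʳ x _ _ (begin
          c ↑ ((3 + 2 * (2 * w)) * r) ∙ x     ≡⟨ conj-↑ (3 + 2 * (2 * w)) xc r ⟨
          x ∙ c ↑ r                           ≡⟨ cong (x ∙_) xx ⟨
          x ∙ (x ∙ x)                         ≡⟨ assoc x x x ⟨
          x ∙ x ∙ x                           ≡⟨ cong (_∙ x) xx ⟩
          c ↑ r ∙ x                           ∎)
        odd-power : ((x ∙ x) ↑ 2) ↑ (1 + 2 * w) ≡ ε
        odd-power = ∙-cancelʳ (c ↑ r) _ _ (begin
          ((x ∙ x) ↑ 2) ↑ (1 + 2 * w) ∙ c ↑ r       ≡⟨ cong (λ y → (y ↑ 2) ↑ (1 + 2 * w) ∙ c ↑ r) xx ⟩
          ((c ↑ r) ↑ 2) ↑ (1 + 2 * w) ∙ c ↑ r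
            ≡⟨ cong (_∙ c ↑ r) (trans (sym (↑-* (c ↑ r) 2 (1 + 2 * w))) (sym (↑-* c r (2 * (1 + 2 * w))))) ⟩
          c ↑ (r * (2 * (1 + 2 * w))) ∙ c ↑ r       ≡⟨ ↑-+ c (r * (2 * (1 + 2 * w))) r ⟨
          c ↑ (r * (2 * (1 + 2 * w)) + r)
            ≡⟨ cong (c ↑_) (solve 2 (λ r w → r :* (con 2 :* (con 1 :+ con 2 :* w)) :+ r
                                          := (con 3 :+ con 2 :* (con 2 :* w)) :* r) refl r w) ⟩
          c ↑ ((3 + 2 * (2 * w)) * r)               ≡⟨ commute ⟩
          c ↑ r                                     ≡⟨ identityˡ _ ⟨
          ε ∙ c ↑ r                                 ∎)
      ... | inj₁ x²≡ε = contradiction (root-in-⟨c⟩ x²≡ε) x∉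
      ... | inj₂ x²≡z = x²≡z

      -- The second equation says x c x⁻¹ = c⁻¹ without inverses, a form that suits the induction on
      -- powers of `c` in the quaternion presentation.
      Inverts : Fin n → Set
      Inverts x = x ∙ x ≡ z × c ∙ (x ∙ c) ≡ x

      -- The exponent `u` must be 3 modulo 4: even values are impossible, and 1 modulo 4 puts `x`
      -- into ⟨c⟩. The product x c acts on ⟨c⟩ as `x` does, so x² and (x c)² = c^(u+1) x² both equal
      -- `z`, whence c^(u+1) = ε.
      square-in-⟨c⟩ : ∀ {x u} → x ∙ c ≡ c ↑ u ∙ x → x ∙ x ∈⟨ c ⟩ → ¬ (x ∈⟨ c ⟩) → Inverts x × c ↑ (u + 1) ≡ ε
      square-in-⟨c⟩ {x} {u} xc (r , c^r) x∉ with even⊎odd u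
      ... | v , inj₁ refl = contradiction xc (conj-≢-even v)
      ... | v , inj₂ refl with even⊎odd v
      ...   | w , inj₁ refl = contradiction (conj-1mod4 {r = r} w xc (sym c^r)) x∉
      ...   | w , inj₂ refl = (x² , (begin
        c ∙ (x ∙ c)              ≡⟨ cong (c ∙_) xc ⟩
        c ∙ (c ↑ u′ ∙ x)         ≡⟨ assoc c _ x ⟨
        c ↑ suc u′ ∙ x           ≡⟨ cong (λ e → c ↑ e ∙ x) (+-comm 1 u′) ⟩
        c ↑ (u′ + 1) ∙ x         ≡⟨ cong (_∙ x) c^u+1 ⟩
        ε ∙ x                    ≡⟨ identityˡ x ⟩
        x                        ∎)) , c^u+1
        where
        open ≡-Reasoning
        open +-*-Solver
        u′ = 1 + 2 * (1 + 2 * w)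
        u≡3+4w : u′ ≡ 3 + 2 * (2 * w)
        u≡3+4w = solve 1 (λ w → con 1 :+ con 2 :* (con 1 :+ con 2 :* w) := con 3 :+ con 2 :* (con 2 :* w)) refl w
        conj : ∀ {y} → y ∙ c ≡ c ↑ u′ ∙ y → y ∙ c ≡ c ↑ (3 + 2 * (2 * w)) ∙ y
        conj {y} eq = trans eq (cong (λ e → c ↑ e ∙ y) u≡3+4w)
        x² : x ∙ x ≡ z
        x² = conj-3mod4 {r = r} w (conj xc) (sym c^r) x∉
        y = x ∙ c ↑ 1
        yy : y ∙ y ≡ c ↑ (u′ * 1 + 1 + r)
        yy = square-of-xc^j {u = u′} {r} xc (sym c^r) 1
        yc : y ∙ c ≡ c ↑ u′ ∙ y
        yc = begin
          x ∙ c ↑ 1 ∙ c          ≡⟨ cong (λ d → x ∙ d ∙ c) (↑-1 c) ⟩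
          x ∙ c ∙ c              ≡⟨ cong (_∙ c) xc ⟩
          c ↑ u′ ∙ x ∙ c         ≡⟨ assoc _ x c ⟩
          c ↑ u′ ∙ (x ∙ c)       ≡⟨ cong (λ d → c ↑ u′ ∙ (x ∙ d)) (↑-1 c) ⟨
          c ↑ u′ ∙ (x ∙ c ↑ 1)   ∎
        c^u+1 : c ↑ (u′ + 1) ≡ ε
        c^u+1 = ∙-cancelʳ (c ↑ r) _ _ (begin
          c ↑ (u′ + 1) ∙ c ↑ r     ≡⟨ ↑-+ c (u′ + 1) r ⟨
          c ↑ (u′ + 1 + r)         ≡⟨ cong (λ e → c ↑ (e + 1 + r)) (*-identityʳ u′) ⟨
          c ↑ (u′ * 1 + 1 + r)     ≡⟨ yy ⟨
          y ∙ y                    ≡⟨ conj-3mod4 {r = u′ * 1 + 1 + r} w (conj yc) yy (x∉ ∘ cyc-cancelʳ (cyc-↑ c 1)) ⟩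
          z                        ≡⟨ x² ⟨
          x ∙ x                    ≡⟨ c^r ⟨
          c ↑ r                    ≡⟨ identityˡ _ ⟨
          ε ∙ c ↑ r                ∎)

      Normalises : Fin n → Set
      Normalises x = ∃[ u ] x ∙ c ≡ c ↑ u ∙ x

      Normalises-∙ : ∀ {x y} → Normalises x → Normalises y → Normalises (x ∙ y)
      Normalises-∙ {x} {y} (u , xc) (v , yc) = u * v , (begin
        x ∙ y ∙ c             ≡⟨ assoc x y c ⟩
        x ∙ (y ∙ c)           ≡⟨ cong (x ∙_) yc ⟩
        x ∙ (c ↑ v ∙ y)       ≡⟨ assoc x _ y ⟨
        x ∙ c ↑ v ∙ y         ≡⟨ cong (_∙ y) (conj-↑ u xc v) ⟩
        c ↑ (u * v) ∙ x ∙ y   ≡⟨ assoc _ x y ⟩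
        c ↑ (u * v) ∙ (x ∙ y) ∎)
        where open ≡-Reasoning

      -- If x² inverts c while x c = cᵘ x, then u² ≡ -1, which is impossible modulo 4.
      normaliser : ¬ c ∙ c ≡ ε → ∀ {x} → Normalises x → x ∈⟨ c ⟩ ⊎ Inverts x
      normaliser c²≢ε {x} Nx = [ inj₁ , inj₂ ∘ proj₁ ∘ proj₂ ]′ (go (suc k) Nx (subst (_∈⟨ c ⟩) (sym (2^1+k x)) (cyc-ε c)))
        where
        -- The exponent `u` stays visible in the result because the relation obtained for `x ∙ x`,
        -- whose exponent is `u * u`, is what refutes that `x ∙ x` inverts `c`.
        go : ∀ i {x} ((u , _) : Normalises x) → x ↑ (2 ^ i) ∈⟨ c ⟩ → x ∈⟨ c ⟩ ⊎ (¬ (x ∈⟨ c ⟩) × Inverts x × c ↑ (u + 1) ≡ ε)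
        go zero {x} _ x^1∈ = inj₁ (subst (_∈⟨ c ⟩) (↑-1 x) x^1∈)
        go (suc i) {x} (u , xc) x^∈ with x ∈⟨ c ⟩?
        ... | yes x∈ = inj₁ x∈
        ... | no x∉ with go i {x ∙ x} (Normalises-∙ (u , xc) (u , xc))
                        (subst (_∈⟨ c ⟩) (trans (↑-* x 2 (2 ^ i)) (cong (_↑ (2 ^ i)) (↑-2 x))) x^∈)
        ...   | inj₁ xx∈ = inj₂ (x∉ , square-in-⟨c⟩ {u = u} xc xx∈ x∉)
        ...   | inj₂ (_ , _ , c^uu+1) with even⊎odd u
        ...     | v , inj₁ refl = contradiction xc (conj-≢-even v)
        ...     | v , inj₂ refl = contradiction (trans (sym (↑-2 c)) (x^odd≡ε⇒x≡ε (suc k) (v + v * v) (2^1+k (c ↑ 2)) (begin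
          (c ↑ 2) ↑ (1 + 2 * (v + v * v))       ≡⟨ ↑-* c 2 (1 + 2 * (v + v * v)) ⟨
          c ↑ (2 * (1 + 2 * (v + v * v)))
            ≡⟨ cong (c ↑_) (solve 1 (λ v → con 2 :* (con 1 :+ con 2 :* (v :+ v :* v))
                                        := (con 1 :+ con 2 :* v) :* (con 1 :+ con 2 :* v) :+ con 1) refl v) ⟩
          c ↑ ((1 + 2 * v) * (1 + 2 * v) + 1)   ≡⟨ c^uu+1 ⟩
          ε                                     ∎))) c²≢ε
          where
          open ≡-Reasoning
          open +-*-Solver

      normalises⇐conj : ∀ {x} → x ∙ c ∙ x ⁻¹ ∈⟨ c ⟩ → Normalises x
      normalises⇐conj {x} (u , c^u) = u , (begin
        x ∙ c                 ≡⟨ identityʳ _ ⟨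
        x ∙ c ∙ ε             ≡⟨ cong (x ∙ c ∙_) (inverseˡ x) ⟨
        x ∙ c ∙ (x ⁻¹ ∙ x)    ≡⟨ assoc _ _ x ⟨
        x ∙ c ∙ x ⁻¹ ∙ x      ≡⟨ cong (_∙ x) c^u ⟨
        c ↑ u ∙ x             ∎)
        where open ≡-Reasoning

      normalises⇒conj : ∀ {x} → Normalises x → x ∙ c ∙ x ⁻¹ ∈⟨ c ⟩
      normalises⇒conj {x} (u , xc) = u , sym (trans (cong (_∙ x ⁻¹) xc)
        (trans (assoc _ x _) (trans (cong (c ↑ u ∙_) (inverseʳ x)) (identityʳ _))))

      Normalises? : Decidable Normalises
      Normalises? x = map′ normalises⇐conj normalises⇒conj ((x ∙ c ∙ x ⁻¹) ∈⟨ c ⟩?)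

      Normalises-ε : Normalises ε
      Normalises-ε = 1 , trans (identityˡ c) (sym (trans (identityʳ _) (↑-1 c)))

      Normalises-⁻¹ : ∀ {x} → Normalises x → Normalises (x ⁻¹)
      Normalises-⁻¹ {x} Nx with cyc-⁻¹ (cyc-refl x)
      ... | m , eq = subst Normalises eq (go m)
        where
        go : ∀ m → Normalises (x ↑ m)
        go zero = Normalises-ε
        go (suc m) = Normalises-∙ Nx (go m)

      -- By `normaliser` the conjugate x c x⁻¹ either lies in ⟨c⟩, as wanted, or has square `z`. As
      -- `z` is central, the latter would give c² = z.
      normalises-conj : ¬ c ∙ c ≡ ε → ¬ c ∙ c ≡ z → ∀ x → Normalises (x ∙ c ∙ x ⁻¹) → Normalises x
      normalises-conj c²≢ε c²≢z x Ny with normaliser c²≢ε Ny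
      ... | inj₁ y∈ = normalises⇐conj y∈
      ... | inj₂ (y² , _) = contradiction (∙-cancelˡ x _ _ (∙-cancelʳ (x ⁻¹) _ _ (begin
        x ∙ (c ∙ c) ∙ x ⁻¹               ≡⟨ cong (_∙ x ⁻¹) (assoc x c c) ⟨
        x ∙ c ∙ c ∙ x ⁻¹                 ≡⟨ assoc (x ∙ c) c _ ⟩
        x ∙ c ∙ (c ∙ x ⁻¹)               ≡⟨ cong (x ∙ c ∙_) (identityˡ _) ⟨
        x ∙ c ∙ (ε ∙ (c ∙ x ⁻¹))         ≡⟨ cong (λ w → x ∙ c ∙ (w ∙ (c ∙ x ⁻¹))) (inverseˡ x) ⟨
        x ∙ c ∙ (x ⁻¹ ∙ x ∙ (c ∙ x ⁻¹))  ≡⟨ cong (x ∙ c ∙_) (assoc _ x _) ⟩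
        x ∙ c ∙ (x ⁻¹ ∙ (x ∙ (c ∙ x ⁻¹))) ≡⟨ cong (λ w → x ∙ c ∙ (x ⁻¹ ∙ w)) (assoc x c _) ⟨
        x ∙ c ∙ (x ⁻¹ ∙ (x ∙ c ∙ x ⁻¹))  ≡⟨ assoc _ _ _ ⟨
        x ∙ c ∙ x ⁻¹ ∙ (x ∙ c ∙ x ⁻¹)    ≡⟨ y² ⟩
        z                                ≡⟨ identityʳ z ⟨
        z ∙ ε                            ≡⟨ cong (z ∙_) (inverseʳ x) ⟨
        z ∙ (x ∙ x ⁻¹)                   ≡⟨ assoc z x _ ⟨
        z ∙ x ∙ x ⁻¹                     ≡⟨ cong (_∙ x ⁻¹) (z-central x) ⟨
        x ∙ z ∙ x ⁻¹                     ∎))) c²≢z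
        where open ≡-Reasoning

      fourth-root-of-ε : ∀ {x} → x ↑ 4 ≡ ε → x ∙ x ≡ ε ⊎ x ∙ x ≡ z
      fourth-root-of-ε {x} x^4 = involution-unique
        (trans (sym (trans (↑-* x 2 2) (trans (↑-2 _) (cong₂ _∙_ (↑-2 x) (↑-2 x))))) x^4)

      ∈⟨z⟩-central : ∀ {y} → y ≡ ε ⊎ y ≡ z → ∀ x → x ∙ y ≡ y ∙ x
      ∈⟨z⟩-central (inj₁ refl) x = trans (identityʳ x) (sym (identityˡ x))
      ∈⟨z⟩-central (inj₂ refl) x = z-central x

      -- All squares lie in {ε , z}, so x c and c x differ by a central element of ⟨c⟩.
      exponent-4⇒normalises : (∀ x → x ↑ 4 ≡ ε) → ∀ x → Normalises x
      exponent-4⇒normalises x^4 x = proj₁ w∈ , trans xc (cong (_∙ x) (sym (proj₂ w∈)))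
        where
        open ≡-Reasoning
        a b d : Fin n
        a = x ∙ c ∙ (x ∙ c)
        b = c ∙ c
        d = x ∙ x
        square : ∀ y → y ∙ y ≡ ε ⊎ y ∙ y ≡ z
        square y = fourth-root-of-ε (x^4 y)
        square∈ : ∀ y → y ∙ y ∈⟨ c ⟩
        square∈ y with y ∙ y | square y
        ... | _ | inj₁ refl = cyc-ε c
        ... | _ | inj₂ refl = z∈⟨_⟩ c≢ε
        -- Expanded, `a ∙ c ∙ x` contains the squares `b` and `d`. They are central, so they move to
        -- the front and leave `x ∙ c`.
        key : d ∙ b ∙ (x ∙ c) ≡ a ∙ c ∙ x
        key = sym (begin
          a ∙ c ∙ x
            ≡⟨ ∙-solve 2 (λ x c → (((x ⊕ c) ⊕ (x ⊕ c)) ⊕ c) ⊕ x ⊜ ((x ⊕ c) ⊕ (x ⊕ (c ⊕ c))) ⊕ x) refl x c ⟩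
          x ∙ c ∙ (x ∙ b) ∙ x                ≡⟨ cong (λ w → x ∙ c ∙ w ∙ x) (∈⟨z⟩-central (square c) x) ⟩
          x ∙ c ∙ (b ∙ x) ∙ x
            ≡⟨ ∙-solve 3 (λ x c b → ((x ⊕ c) ⊕ (b ⊕ x)) ⊕ x ⊜ ((x ⊕ c) ⊕ b) ⊕ (x ⊕ x)) refl x c b ⟩
          x ∙ c ∙ b ∙ d                      ≡⟨ ∈⟨z⟩-central (square x) (x ∙ c ∙ b) ⟩
          d ∙ (x ∙ c ∙ b)                    ≡⟨ cong (d ∙_) (∈⟨z⟩-central (square c) (x ∙ c)) ⟩
          d ∙ (b ∙ (x ∙ c))                  ≡⟨ assoc d b _ ⟨
          d ∙ b ∙ (x ∙ c)                    ∎)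
        w = (d ∙ b) ⁻¹ ∙ (a ∙ c)
        w∈ : w ∈⟨ c ⟩
        w∈ = cyc-∙ (cyc-⁻¹ (cyc-∙ (square∈ x) (square∈ c))) (cyc-∙ (square∈ (x ∙ c)) (cyc-refl c))
        xc : x ∙ c ≡ w ∙ x
        xc = ∙-cancelˡ (d ∙ b) _ _ (begin
          d ∙ b ∙ (x ∙ c)                        ≡⟨ key ⟩
          a ∙ c ∙ x                              ≡⟨ identityˡ _ ⟨
          ε ∙ (a ∙ c ∙ x)                        ≡⟨ cong (_∙ (a ∙ c ∙ x)) (inverseʳ (d ∙ b)) ⟨
          d ∙ b ∙ (d ∙ b) ⁻¹ ∙ (a ∙ c ∙ x)
            ≡⟨ ∙-solve 5 (λ p q a c x → (p ⊕ q) ⊕ ((a ⊕ c) ⊕ x) ⊜ p ⊕ ((q ⊕ (a ⊕ c)) ⊕ x))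
                 refl (d ∙ b) ((d ∙ b) ⁻¹) a c x ⟩
          d ∙ b ∙ (w ∙ x)                        ∎)

    -- The order of `c` is 2 · 2ᵏ, so in the quaternion case `k` becomes the parameter t. The bound
    -- `1 ≤ k` is kept for that purpose.
    Structure : ℕ → Fin n → Set
    Structure k c = (∀ x → x ∈⟨ c ⟩) ⊎ (1 ≤ k × (∀ x → x ∈⟨ c ⟩ ⊎ (x ∙ x ≡ z × c ∙ (x ∙ c) ≡ x)))

    -- In exponent 2 every element is `ε` or `z`; in exponent 4 normality of ⟨c⟩ is a direct
    -- computation. From exponent 8 on, c² is neither `ε` nor `z`, and the coset argument shows that
    -- the normaliser of ⟨c⟩ is all of `G`.
    structure : ∀ k {c} → (∀ x → x ↑ (2 ^ suc k) ≡ ε) → ¬ c ↑ (2 ^ k) ≡ ε → Structure k c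
    structure zero 2^1+k c≢ = inj₁ λ x → root-in-⟨c⟩ (trans (sym (↑-2 x)) (2^1+k x))
      where open MaximalCyclic zero 2^1+k c≢
    structure (suc zero) {c} 2^1+k c≢ = inj₂ (s≤s z≤n ,
      λ x → normaliser (c≢ ∘ trans (↑-2 c)) (exponent-4⇒normalises 2^1+k x))
      where open MaximalCyclic (suc zero) 2^1+k c≢
    structure (suc (suc k)) {c} 2^1+k c≢ = inj₂ (s≤s z≤n , λ x → normaliser c²≢ε
      (self-normalising⇒whole Normalises? Normalises-ε Normalises-∙ Normalises-⁻¹
        2-element {c} (1 , cong (_∙ c) (sym (↑-1 c))) (normalises-conj c²≢ε c²≢z) x))
      where
      open Cosets G
      open MaximalCyclic (suc (suc k)) 2^1+k c≢
      c²≢ε : ¬ c ∙ c ≡ ε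
      c²≢ε c² = c≢ (↑2^-mono {c} {1} {suc (suc k)} (s≤s z≤n) (trans (↑-2 c) c²))
      c²≢z : ¬ c ∙ c ≡ z
      c²≢z c² = c≢ (↑2^-mono {c} {2} {suc (suc k)} (s≤s (s≤s z≤n))
        (trans (↑-* c 2 2) (trans (↑-2 _) (trans (cong₂ _∙_ (trans (↑-2 c) c²) (trans (↑-2 c) c²)) z²≡ε))))

-- Cyclic and generalized quaternion 2-groups.

module Presentations {n : ℕ} (G : FinGroup n) where
  open import Algebra.Solver.Monoid (Group.monoid (GroupTheory.group G)) using (_⊕_; _⊜_) renaming (solve to ∙-solve)
  open GroupTheory G
  open StrongDimension G
  open DimensionFormulas G
  open TwoElements G
  open Classification G

  mkIso : ∀ {A : Set} {_⋆_ : A → A → A} (f : A → Fin n) → (∀ {a b} → f a ≡ f b → a ≡ b) →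
    (∀ x → ∃[ a ] f a ≡ x) → (∀ a b → f (a ⋆ b) ≡ f a ∙ f b) → Iso G A _⋆_
  mkIso f injective surjective homo = record
    { to = λ x → proj₁ (surjective x)
    ; from = f
    ; from-to = λ x → proj₂ (surjective x)
    ; to-from = λ a → injective (proj₂ (surjective (f a)))
    ; hom = λ x y → injective (trans (proj₂ (surjective (x ∙ y)))
        (sym (trans (homo _ _) (cong₂ _∙_ (proj₂ (surjective x)) (proj₂ (surjective y))))))
    }

  ↑-mod : ∀ {x} m .{{_ : NonZero m}} → x ↑ m ≡ ε → ∀ k → x ↑ toℕ (k mod m) ≡ x ↑ k
  ↑-mod {x} m x^m k = trans (cong (x ↑_) (toℕ-fromℕ< (m%n<n k m))) (↑-% x m k x^m)

  cyclic⇒IsoZ : ∀ {c m} .{{_ : NonZero m}} → HasOrder G c m → (∀ x → x ∈⟨ c ⟩) → IsoZ G m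
  cyclic⇒IsoZ {c} {m} oc@(1≤m , c^m , _) generates = mkIso (λ i → c ↑ toℕ i)
    (λ {i} {j} eq → toℕ-injective (↑-injective oc (toℕ<n i) (toℕ<n j) eq))
    (λ x → cyc-reduce m 1≤m c^m (generates x))
    λ i j → trans (↑-mod m c^m (toℕ i + toℕ j)) (↑-+ c (toℕ i) (toℕ j))

  -- Each element has a unique normal form cⁱ or cⁱ g. Moving `g` past powers of `c` inverts them,
  -- and `g ∙ g` is c^m, which is the multiplication table `qop`.
  inverting⇒IsoQ : ∀ {c g m} .{{_ : NonZero m}} → HasOrder G c (2 * m) → ¬ (g ∈⟨ c ⟩) → g ∙ g ≡ c ↑ m → c ∙ (g ∙ c) ≡ g →
    (∀ x → x ∈⟨ c ⟩ ⊎ ∃[ y ] (y ∈⟨ c ⟩ × y ∙ g ≡ x)) → IsoQ G m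
  inverting⇒IsoQ {c} {g} {m} oc@(1≤2m , c^2m , _) g∉ g² inverts cosets = mkIso f injective surjective homo
    where
    open ≡-Reasoning
    instance
      _ : NonZero (2 * m)
      _ = m*n≢0 2 m
    f : Fin (2 * m) × Bool → Fin n
    f (i , false) = c ↑ toℕ i
    f (i , true) = c ↑ toℕ i ∙ g
    c↑-injective : ∀ {i j : Fin (2 * m)} → c ↑ toℕ i ≡ c ↑ toℕ j → i ≡ j
    c↑-injective {i} {j} eq = toℕ-injective (↑-injective oc (toℕ<n i) (toℕ<n j) eq)
    disjoint : ∀ i j → ¬ c ↑ i ≡ c ↑ j ∙ g
    disjoint i j eq = g∉ (subst (_∈⟨ c ⟩) (trans (cong ((c ↑ j) ⁻¹ ∙_) eq)
      (trans (sym (assoc _ _ g)) (trans (cong (_∙ g) (inverseˡ _)) (identityˡ g)))) (cyc-∙ (cyc-⁻¹ (cyc-↑ c j)) (cyc-↑ c i)))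
    injective : ∀ {a b} → f a ≡ f b → a ≡ b
    injective {i , false} {j , false} eq = cong (_, false) (c↑-injective eq)
    injective {i , false} {j , true} eq = contradiction eq (disjoint (toℕ i) (toℕ j))
    injective {i , true} {j , false} eq = contradiction (sym eq) (disjoint (toℕ j) (toℕ i))
    injective {i , true} {j , true} eq = cong (_, true) (c↑-injective (∙-cancelʳ g _ _ eq))
    surjective : ∀ x → ∃[ a ] f a ≡ x
    surjective x with cosets x
    ... | inj₁ x∈ = let i , eq = cyc-reduce (2 * m) 1≤2m c^2m x∈ in (i , false) , eq
    ... | inj₂ (y , y∈ , refl) = let i , eq = cyc-reduce (2 * m) 1≤2m c^2m y∈ in (i , true) , cong (_∙ g) eq
    inverts-↑ : ∀ j → c ↑ j ∙ (g ∙ c ↑ j) ≡ g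
    inverts-↑ zero = trans (identityˡ _) (identityʳ g)
    inverts-↑ (suc j) = begin
      c ∙ c ↑ j ∙ (g ∙ (c ∙ c ↑ j))     ≡⟨ cong₂ (λ y z → y ∙ (g ∙ z)) (c↑suc j) refl ⟩
      c ↑ j ∙ c ∙ (g ∙ (c ∙ c ↑ j))
        ≡⟨ ∙-solve 3 (λ c d g → (d ⊕ c) ⊕ (g ⊕ (c ⊕ d)) ⊜ d ⊕ ((c ⊕ (g ⊕ c)) ⊕ d)) refl c (c ↑ j) g ⟩
      c ↑ j ∙ (c ∙ (g ∙ c) ∙ c ↑ j)     ≡⟨ cong (λ y → c ↑ j ∙ (y ∙ c ↑ j)) inverts ⟩
      c ↑ j ∙ (g ∙ c ↑ j)               ≡⟨ inverts-↑ j ⟩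
      g                                 ∎
      where
      c↑suc : ∀ j → c ∙ c ↑ j ≡ c ↑ j ∙ c
      c↑suc j = trans (cong (_∙ c ↑ j) (sym (↑-1 c))) (trans (↑-comm c 1 j) (cong (c ↑ j ∙_) (↑-1 c)))
    -- The exponent `2 * m ∸ toℕ j` plays the role of -j, as in `qop`. The subtraction is not
    -- truncated because j < 2m.
    g∙c↑ : ∀ (j : Fin (2 * m)) → g ∙ c ↑ toℕ j ≡ c ↑ (2 * m ∸ toℕ j) ∙ g
    g∙c↑ j = sym (begin
      c ↑ (2 * m ∸ toℕ j) ∙ g                                 ≡⟨ cong (c ↑ (2 * m ∸ toℕ j) ∙_) (inverts-↑ (toℕ j)) ⟨
      c ↑ (2 * m ∸ toℕ j) ∙ (c ↑ toℕ j ∙ (g ∙ c ↑ toℕ j))     ≡⟨ assoc _ _ _ ⟨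
      c ↑ (2 * m ∸ toℕ j) ∙ c ↑ toℕ j ∙ (g ∙ c ↑ toℕ j)       ≡⟨ cong (_∙ (g ∙ c ↑ toℕ j)) (↑-+ c (2 * m ∸ toℕ j) (toℕ j)) ⟨
      c ↑ (2 * m ∸ toℕ j + toℕ j) ∙ (g ∙ c ↑ toℕ j)
        ≡⟨ cong (_∙ (g ∙ c ↑ toℕ j)) (trans (cong (c ↑_) (m∸n+n≡m (<⇒≤ (toℕ<n j)))) c^2m) ⟩
      ε ∙ (g ∙ c ↑ toℕ j)                                     ≡⟨ identityˡ _ ⟩
      g ∙ c ↑ toℕ j                                           ∎)
    reduce : ∀ k → c ↑ toℕ (k mod (2 * m)) ≡ c ↑ k
    reduce = ↑-mod (2 * m) c^2m
    homo : ∀ a b → f (qop m a b) ≡ f a ∙ f b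
    homo (i , false) (j , false) = trans (reduce (toℕ i + toℕ j)) (↑-+ c (toℕ i) (toℕ j))
    homo (i , false) (j , true) = trans (cong (_∙ g) (trans (reduce (toℕ i + toℕ j)) (↑-+ c (toℕ i) (toℕ j)))) (assoc _ _ g)
    homo (i , true) (j , false) = begin
      c ↑ toℕ ((toℕ i + (2 * m ∸ toℕ j)) mod (2 * m)) ∙ g  ≡⟨ cong (_∙ g) (reduce (toℕ i + (2 * m ∸ toℕ j))) ⟩
      c ↑ (toℕ i + (2 * m ∸ toℕ j)) ∙ g                    ≡⟨ cong (_∙ g) (↑-+ c (toℕ i) _) ⟩
      c ↑ toℕ i ∙ c ↑ (2 * m ∸ toℕ j) ∙ g                  ≡⟨ assoc _ _ g ⟩
      c ↑ toℕ i ∙ (c ↑ (2 * m ∸ toℕ j) ∙ g)                ≡⟨ cong (c ↑ toℕ i ∙_) (g∙c↑ j) ⟨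
      c ↑ toℕ i ∙ (g ∙ c ↑ toℕ j)                          ≡⟨ assoc _ g _ ⟨
      c ↑ toℕ i ∙ g ∙ c ↑ toℕ j                            ∎
    homo (i , true) (j , true) = begin
      c ↑ toℕ ((toℕ i + (2 * m ∸ toℕ j) + m) mod (2 * m))  ≡⟨ reduce (toℕ i + (2 * m ∸ toℕ j) + m) ⟩
      c ↑ (toℕ i + (2 * m ∸ toℕ j) + m)                    ≡⟨ ↑-+ c (toℕ i + (2 * m ∸ toℕ j)) m ⟩
      c ↑ (toℕ i + (2 * m ∸ toℕ j)) ∙ c ↑ m                ≡⟨ cong₂ _∙_ (↑-+ c (toℕ i) _) (sym g²) ⟩
      c ↑ toℕ i ∙ c ↑ (2 * m ∸ toℕ j) ∙ (g ∙ g)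
        ≡⟨ ∙-solve 3 (λ a b g → (a ⊕ b) ⊕ (g ⊕ g) ⊜ (a ⊕ (b ⊕ g)) ⊕ g) refl _ _ g ⟩
      c ↑ toℕ i ∙ (c ↑ (2 * m ∸ toℕ j) ∙ g) ∙ g            ≡⟨ cong (λ y → c ↑ toℕ i ∙ y ∙ g) (g∙c↑ j) ⟨
      c ↑ toℕ i ∙ (g ∙ c ↑ toℕ j) ∙ g
        ≡⟨ ∙-solve 3 (λ a b g → (a ⊕ (g ⊕ b)) ⊕ g ⊜ (a ⊕ g) ⊕ (b ⊕ g)) refl _ _ g ⟩
      c ↑ toℕ i ∙ g ∙ (c ↑ toℕ j ∙ g)                      ∎

  -- If some `g` lies outside ⟨c⟩, then any other outside `x` inverts `c` as well. So `x ∙ g`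
  -- centralises `c` and lies in ⟨c⟩, and ⟨c⟩ has just two cosets.
  classification : ∀ {z} → UniversalInvolution z → (∃[ k ] (1 ≤ k × IsoZ2^ G k)) ⊎ (∃[ t ] (1 ≤ t × IsoQ2^ G t))
  classification {z} uz = let k , c , 2^1+k , c≢ = maximal-cyclic uz in go k c 2^1+k c≢ (structure uz k 2^1+k c≢)
    where
    open UniversalInvolution uz
    go : ∀ k c → (∀ x → x ↑ (2 ^ suc k) ≡ ε) → ¬ c ↑ (2 ^ k) ≡ ε → Structure uz k c →
      (∃[ k ] (1 ≤ k × IsoZ2^ G k)) ⊎ (∃[ t ] (1 ≤ t × IsoQ2^ G t))
    go k c 2^1+k c≢ (inj₁ generates) =
      inj₁ (suc k , s≤s z≤n , cyclic⇒IsoZ {{m^n≢0 2 (suc k)}} (hasOrder-2^ k (2^1+k c) c≢) generates)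
    go k c 2^1+k c≢ (inj₂ (1≤k , alternative)) with any? (λ x → ¬? (x ∈⟨ c ⟩?))
    ... | no ¬outside = go k c 2^1+k c≢ (inj₁ λ x → decidable-stable (x ∈⟨ c ⟩?) λ x∉ → ¬outside (x , x∉))
    ... | yes (g , g∉) = inj₂ (k , 1≤k , inverting⇒IsoQ {{m^n≢0 2 k}}
      (hasOrder-2^ k (2^1+k c) c≢) g∉ (trans g² (sym c^2^k≡z)) cgc cosets)
      where
      open MaximalCyclic uz k 2^1+k c≢
      open ≡-Reasoning
      g-inverts : g ∙ g ≡ z × c ∙ (g ∙ c) ≡ g
      g-inverts = [ (λ g∈ → contradiction g∈ g∉) , id ]′ (alternative g)
      g² = proj₁ g-inverts
      cgc = proj₂ g-inverts
      cosets : ∀ x → x ∈⟨ c ⟩ ⊎ ∃[ y ] (y ∈⟨ c ⟩ × y ∙ g ≡ x)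
      cosets x with alternative x
      ... | inj₁ x∈ = inj₁ x∈
      -- The witness is x g⁻¹: since `g ∙ g` is the involution `z`, the inverse of `g` is `g ∙ z`.
      ... | inj₂ (_ , cxc) = inj₂ (x ∙ g ∙ z , cyc-∙ (centralizer xgc) (z∈⟨_⟩ c≢ε) , (begin
        x ∙ g ∙ z ∙ g         ≡⟨ cong (_∙ g) (z-central uz (x ∙ g)) ⟩
        z ∙ (x ∙ g) ∙ g       ≡⟨ ∙-solve 3 (λ z x g → (z ⊕ (x ⊕ g)) ⊕ g ⊜ (z ⊕ x) ⊕ (g ⊕ g)) refl z x g ⟩
        z ∙ x ∙ (g ∙ g)       ≡⟨ cong₂ _∙_ (z-central uz x) (sym g²) ⟨
        x ∙ z ∙ z             ≡⟨ assoc x z z ⟩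
        x ∙ (z ∙ z)           ≡⟨ cong (x ∙_) z²≡ε ⟩
        x ∙ ε                 ≡⟨ identityʳ x ⟩
        x                     ∎))
        where
        xgc : x ∙ g ∙ c ≡ c ∙ (x ∙ g)
        xgc = begin
          x ∙ g ∙ c                   ≡⟨ cong (λ y → y ∙ g ∙ c) cxc ⟨
          c ∙ (x ∙ c) ∙ g ∙ c
            ≡⟨ ∙-solve 3 (λ c x g → ((c ⊕ (x ⊕ c)) ⊕ g) ⊕ c ⊜ c ⊕ (x ⊕ (c ⊕ (g ⊕ c)))) refl c x g ⟩
          c ∙ (x ∙ (c ∙ (g ∙ c)))     ≡⟨ cong (λ y → c ∙ (x ∙ y)) cgc ⟩
          c ∙ (x ∙ g)                 ∎

  -- An embedding of the cyclic group, rather than an isomorphism, is assumed so that the cyclic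
  -- half of a quaternion group is covered too.
  module CyclicImage {m : ℕ} .{{_ : NonZero m}} (ϕ : Fin m → Fin n)
    (ϕ-injective : ∀ {i j} → ϕ i ≡ ϕ j → i ≡ j) (ϕ-hom : ∀ i j → ϕ (zop m i j) ≡ ϕ i ∙ ϕ j) where

    open ≡-Reasoning

    c : Fin n
    c = ϕ (1 mod m)

    toℕ-mod : ∀ j → toℕ (j mod m) ≡ j % m
    toℕ-mod j = toℕ-fromℕ< (m%n<n j m)

    toℕ-0 : toℕ (0 mod m) ≡ 0
    toℕ-0 = trans (toℕ-mod 0) (m*n%n≡0 0 m)

    mod-+ : ∀ i j → zop m (i mod m) (j mod m) ≡ (i + j) mod m
    mod-+ i j = toℕ-injective (begin
      toℕ (zop m (i mod m) (j mod m))            ≡⟨ toℕ-mod _ ⟩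
      (toℕ (i mod m) + toℕ (j mod m)) % m        ≡⟨ cong₂ (λ a b → (a + b) % m) (toℕ-mod i) (toℕ-mod j) ⟩
      (i % m + j % m) % m                        ≡⟨ %-distribˡ-+ i j m ⟨
      (i + j) % m                                ≡⟨ toℕ-mod (i + j) ⟨
      toℕ ((i + j) mod m)                        ∎)

    ϕ-0 : ϕ (0 mod m) ≡ ε
    ϕ-0 = ∙-cancelˡ (ϕ (0 mod m)) _ _ (trans (sym (ϕ-hom _ _)) (trans (cong ϕ (mod-+ 0 0)) (sym (identityʳ _))))

    c↑ : ∀ j → c ↑ j ≡ ϕ (j mod m)
    c↑ zero = sym ϕ-0
    c↑ (suc j) = trans (cong (c ∙_) (c↑ j)) (trans (sym (ϕ-hom _ _)) (cong ϕ (mod-+ 1 j)))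

    c-order : HasOrder G c m
    c-order = n≢0⇒n>0 (≢-nonZero⁻¹ m) ,
      trans (c↑ m) (trans (cong ϕ (toℕ-injective (trans (toℕ-mod m) (trans (n%n≡0 m) (sym toℕ-0))))) ϕ-0) ,
      λ j 1≤j j<m c^j → <⇒≢ 1≤j (sym (begin
        j                 ≡⟨ m<n⇒m%n≡m j<m ⟨
        j % m             ≡⟨ toℕ-mod j ⟨
        toℕ (j mod m)     ≡⟨ cong toℕ (ϕ-injective (trans (sym (c↑ j)) (trans c^j (sym ϕ-0)))) ⟩
        toℕ (0 mod m)     ≡⟨ toℕ-0 ⟩
        0                 ∎))

    ϕ∈⟨c⟩ : ∀ i → c ↑ toℕ i ≡ ϕ i
    ϕ∈⟨c⟩ i = trans (c↑ (toℕ i)) (cong ϕ (toℕ-injective (trans (toℕ-mod (toℕ i)) (m<n⇒m%n≡m (toℕ<n i)))))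

    ϕ-exponent : ∀ i → ϕ i ↑ m ≡ ε
    ϕ-exponent i = cyc-exponent m (proj₁ (proj₂ c-order)) (toℕ i , ϕ∈⟨c⟩ i)

    -- The order 2l of `c` divides 2i, so l divides i, and i < 2l leaves only 0 and l.
    ϕ-involution : ∀ {l} → m ≡ 2 * l → ∀ i → ϕ i ∙ ϕ i ≡ ε → ϕ i ≡ ε ⊎ ϕ i ≡ c ↑ l
    ϕ-involution {l} refl i sq with *-cancelˡ-∣ {l} {toℕ i} 2 (HasOrder-∣ c-order (begin
        c ↑ (2 * toℕ i)              ≡⟨ cong (c ↑_) (*-comm 2 (toℕ i)) ⟩
        c ↑ (toℕ i * 2)              ≡⟨ ↑-* c (toℕ i) 2 ⟩
        (c ↑ toℕ i) ↑ 2              ≡⟨ trans (↑-2 _) (cong₂ _∙_ (ϕ∈⟨c⟩ i) (ϕ∈⟨c⟩ i)) ⟩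
        ϕ i ∙ ϕ i                    ≡⟨ sq ⟩
        ε                            ∎))
    ... | divides zero eq = inj₁ (trans (sym (ϕ∈⟨c⟩ i)) (cong (c ↑_) eq))
    ... | divides (suc zero) eq = inj₂ (trans (sym (ϕ∈⟨c⟩ i)) (cong (c ↑_) (trans eq (+-identityʳ l))))
    ... | divides (suc (suc q)) eq = contradiction (toℕ<n i)
      (≤⇒≯ (≤-trans (*-monoˡ-≤ l (s≤s (s≤s (z≤n {q})))) (≤-reflexive (sym eq))))

    half-order : ∀ {l} → m ≡ 2 * l → 1 ≤ l → ¬ c ↑ l ≡ ε × c ↑ l ∙ c ↑ l ≡ ε
    half-order {l} refl 1≤l = proj₂ (proj₂ c-order) l 1≤l
      (m<m+n l (≤-trans 1≤l (≤-reflexive (sym (+-identityʳ l))))) , (begin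
      c ↑ l ∙ c ↑ l     ≡⟨ ↑-2 _ ⟨
      (c ↑ l) ↑ 2       ≡⟨ ↑-* c l 2 ⟨
      c ↑ (l * 2)       ≡⟨ cong (c ↑_) (*-comm l 2) ⟩
      c ↑ (2 * l)       ≡⟨ proj₁ (proj₂ c-order) ⟩
      ε                 ∎)

  Iso⇒↔ : ∀ {A : Set} {_⋆_} → Iso G A _⋆_ → Fin n ↔ A
  Iso⇒↔ iso = mk↔ₛ′ to from to-from from-to
    where open Iso iso

  from-hom : ∀ {A : Set} {_⋆_} (iso : Iso G A _⋆_) → let open Iso iso in ∀ a b → from (a ⋆ b) ≡ from a ∙ from b
  from-hom {_⋆_ = _⋆_} iso a b = trans (cong from (sym (trans (hom _ _) (cong₂ _⋆_ (to-from a) (to-from b))))) (from-to _)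
    where open Iso iso

  from-injective : ∀ {A : Set} {_⋆_} (iso : Iso G A _⋆_) → let open Iso iso in ∀ {a b} → from a ≡ from b → a ≡ b
  from-injective iso {a} {b} eq = trans (sym (to-from a)) (trans (cong to eq) (to-from b))
    where open Iso iso

  sdim-IsoZ2^ : ∀ k → 1 ≤ k → IsoZ2^ G k → SDimIs G (2 ^ k ∸ k)
  sdim-IsoZ2^ (suc k) _ iso = subst (λ m → SDimIs G (m ∸ suc k)) (↔⇒≡ (Iso⇒↔ iso)) (sdim-with-twins
    (unique-involution⇒universal (suc k) (proj₁ half) (proj₂ half)
      (λ x → subst (λ x → x ∙ x ≡ ε → x ≡ ε ⊎ x ≡ c ↑ (2 ^ k)) (from-to x) (ϕ-involution {2 ^ k} refl (to x)))
      x^2^k≡ε)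
    c-order x^2^k≡ε)
    where
    open Iso iso
    instance
      _ : NonZero (2 ^ suc k)
      _ = m^n≢0 2 (suc k)
    open CyclicImage {2 ^ suc k} from (from-injective iso) (from-hom iso)
    half = half-order {2 ^ k} refl (m^n>0 2 k)
    x^2^k≡ε : ∀ x → x ↑ (2 ^ suc k) ≡ ε
    x^2^k≡ε x = subst (λ x → x ↑ (2 ^ suc k) ≡ ε) (from-to x) (ϕ-exponent (to x))

  -- Elements outside the cyclic half all square to c^m, which is not `ε`, so c^m remains the only
  -- involution. Their fourth powers are trivial, and 4 divides 2^(t+1) because t is positive; thus
  -- `sdim-with-twins` applies with exponent 2^(t+1).
  sdim-IsoQ2^ : ∀ t → 1 ≤ t → IsoQ2^ G t → SDimIs G (2 ^ (t + 2) ∸ t ∸ 1)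
  sdim-IsoQ2^ t 1≤t iso = subst (SDimIs G)
    (trans (cong₂ _∸_ order (+-comm 1 t)) (sym (∸-+-assoc (2 ^ (t + 2)) t 1))) (sdim-with-twins
    (unique-involution⇒universal (suc t) (proj₁ half) (proj₂ half)
      (λ x → subst (λ x → x ∙ x ≡ ε → x ≡ ε ⊎ x ≡ c ↑ m) (from-to x) (unique (to x)))
      x^2^k≡ε)
    c-order x^2^k≡ε)
    where
    open Iso iso
    open ≡-Reasoning
    m = 2 ^ t
    instance
      _ : NonZero (2 * m)
      _ = m*n≢0 2 m {{_}} {{m^n≢0 2 t}}
    open CyclicImage {2 * m} (λ i → from (i , false)) (λ eq → cong proj₁ (from-injective iso eq))
      (λ i j → from-hom iso (i , false) (j , false))
    half = half-order {m} refl (m^n>0 2 t)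
    order : n ≡ 2 ^ (t + 2)
    order = trans (↔⇒≡ (↔-sym *↔× ↔-∘ ((↔-id _ ×-↔ ↔-sym 2↔Bool) ↔-∘ Iso⇒↔ iso)))
      (trans (*-comm (2 * m) 2) (cong (2 ^_) (+-comm 2 t)))
    square-outside : ∀ i → from (i , true) ∙ from (i , true) ≡ c ↑ m
    square-outside i = begin
      from (i , true) ∙ from (i , true)                              ≡⟨ from-hom iso (i , true) (i , true) ⟨
      from ((toℕ i + (2 * m ∸ toℕ i) + m) mod (2 * m) , false)       ≡⟨ c↑ _ ⟨
      c ↑ (toℕ i + (2 * m ∸ toℕ i) + m)
        ≡⟨ cong (λ e → c ↑ (e + m)) (m+[n∸m]≡n (<⇒≤ (toℕ<n i))) ⟩
      c ↑ (2 * m + m)                                                ≡⟨ ↑-+ c (2 * m) m ⟩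
      c ↑ (2 * m) ∙ c ↑ m                                            ≡⟨ cong (_∙ c ↑ m) (proj₁ (proj₂ c-order)) ⟩
      ε ∙ c ↑ m                                                      ≡⟨ identityˡ _ ⟩
      c ↑ m                                                          ∎
    unique : ∀ a → from a ∙ from a ≡ ε → from a ≡ ε ⊎ from a ≡ c ↑ m
    unique (i , false) = ϕ-involution {m} refl i
    unique (i , true) sq = contradiction (trans (sym (square-outside i)) sq) (proj₁ half)
    from-^2^k≡ε : ∀ a → from a ↑ (2 ^ suc t) ≡ ε
    from-^2^k≡ε (i , false) = ϕ-exponent i
    from-^2^k≡ε (i , true) = ↑2^-mono {from (i , true)} {2} {suc t} (s≤s 1≤t) (begin
      x ↑ 4                   ≡⟨ ↑-* x 2 2 ⟩
      (x ↑ 2) ↑ 2             ≡⟨ trans (↑-2 _) (cong₂ _∙_ (↑-2 x) (↑-2 x)) ⟩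
      x ∙ x ∙ (x ∙ x)         ≡⟨ cong₂ _∙_ (square-outside i) (square-outside i) ⟩
      c ↑ m ∙ c ↑ m           ≡⟨ proj₂ half ⟩
      ε                       ∎)
      where x = from (i , true)
    x^2^k≡ε : ∀ x → x ↑ (2 ^ suc t) ≡ ε
    x^2^k≡ε x = subst (λ x → x ↑ (2 ^ suc t) ≡ ε) (from-to x) (from-^2^k≡ε (to x))

theorem5p1 : ∀ (n : ℕ) (G : FinGroup n) →
    ((k : ℕ) → 1 ≤ k → IsoZ2^ G k → SDimIs G (2 ^ k ∸ k)) ×
    ((t : ℕ) → 1 ≤ t → IsoQ2^ G t → SDimIs G (2 ^ (t + 2) ∸ t ∸ 1)) ×
    (((k : ℕ) → 1 ≤ k → ¬ IsoZ2^ G k) → ((t : ℕ) → 1 ≤ t → ¬ IsoQ2^ G t) →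
    (M : ℕ) → IsMaxOmega G M → SDimIs G (n ∸ M ∸ 1))
theorem5p1 n G = sdim-IsoZ2^ , sdim-IsoQ2^ , λ ¬Z ¬Q →
  sdim-without-twins λ z uz →
    [ (λ (k , 1≤k , iso) → ¬Z k 1≤k iso) , (λ (t , 1≤t , iso) → ¬Q t 1≤t iso) ]′ (classification uz)
  where
  open Presentations G
  open DimensionFormulas G
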